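{- Let $q=2^r$. For a double coset $D=DC_i^{\epsilon}(n,q)$ with elements ordered $g_1,\dots,g_N$, and $a\in\mathbb{F}_q$, let $c_i^\epsilon(a)=(tr(a\,\mathrm{Tr}\,g_1),\dots,tr(a\,\mathrm{Tr}\,g_N))\in\mathbb{F}_2^N$. Then the map $\mathbb{F}_q\to C(D)^\perp$, $a\mapsto c_i^\epsilon(a)$, is an $\mathbb{F}_2$-linear isomorphism in each of the following cases: (a) $i\in\{1,2\}$, $\epsilon=+$, $n\ge2$ even, all $q$; (b) $i=3$, $\epsilon=+$, and either $n\ge4$ even and all $q$, or $n=2$ and $q\ge8$; (c) $i=4$, $\epsilon=+$, $n\ge4$ even, all $q$; (d) $i=1$, $\epsilon=-$, $n\ge1$ odd, all $q$; (e) $i\in\{2,3\}$, $\epsilon=-$, $n\ge3$ odd, all $q$; (f) $i=4$, $\epsilon=-$, and either $n\ge5$ odd and all $q$, or $n=3$ and $q\ge4$.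
   Context: $q=2^r$, $tr(x)=x+x^2+\cdots+x^{2^{r-1}}$ the trace $\mathbb{F}_q\to\mathbb{F}_2$. $\mathrm{Tr}$ matrix trace, ${}^tX$ transpose, alternating = symmetric with zero diagonal. Fix $\kappa\in\mathbb{F}_q$ with $z^2+z+\kappa$ irreducible. For $n\ge1$, $O^-(2n,q)$ is the group of $g\in GL(2n,q)$ preserving $\theta^-(x)=\sum_{i=1}^{n-1}x_ix_{n-1+i}+x_{2n-1}^2+x_{2n-1}x_{2n}+\kappa x_{2n}^2$. $\delta=\begin{pmatrix}1&1\\0&\kappa\end{pmatrix}$, $\eta=\begin{pmatrix}0&1\\1&0\end{pmatrix}$, $SO^-(2,q)=\{\begin{pmatrix}d_1&\kappa d_2\\ d_2&d_1+d_2\end{pmatrix}:d_1^2+d_1d_2+\kappa d_2^2=1\}$. $Q=Q^-(2n,q)$ is the group of all products (blocks $n-1,n-1,2$) $\begin{pmatrix}A&0&0\\0&{}^tA^{ -1}&0\\0&0&i\end{pmatrix}\begin{pmatrix}1_{n-1}&B&{}^th\,{}^ti\,\eta\,i\\0&1_{n-1}&0\\0&h&1_2\end{pmatrix}$ with $A\in GL(n-1,q)$, $i\in SO^-(2,q)$, ${}^tB+{}^th\delta h$ alternating. $\rho=\mathrm{diag}(1_{2n-2},\begin{pmatrix}1&1\\0&1\end{pmatrix})$. $\sigma_s$ ($0\le s\le n-1$) is the permutation matrix interchanging $e^j$ and $e^{n-1+j}$ for $1\le j\le s$. $DC_1^+(n,q)=Q\sigma_{n-1}Q$, $DC_2^+(n,q)=Q\sigma_{n-2}Q$,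 $DC_3^+(n,q)=\rho Q\sigma_{n-2}Q$ ($n$ even); $DC_4^+(n,q)=\rho Q\sigma_{n-3}Q$ ($n\ge4$ even); $DC_1^-(n,q)=Q\sigma_{n-1}Q$ ($n$ odd); $DC_2^-(n,q)=Q\sigma_{n-2}Q$, $DC_3^-(n,q)=\rho Q\sigma_{n-2}Q$, $DC_4^-(n,q)=\rho Q\sigma_{n-3}Q$ ($n\ge3$ odd). Code: $C(D)=\{u\in\mathbb{F}_2^N:\sum_{k=1}^Nu_k\mathrm{Tr}(g_k)=0\text{ in }\mathbb{F}_q\}$, and $C(D)^\perp$ is its dual with respect to the standard dot product on $\mathbb{F}_2^N$. -}

module Defs where

open import Data.Nat as ℕ using (ℕ; zero; suc; _^_; _≤_; _∸_)
open import Data.Nat.Divisibility using (_∣_)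
open import Data.Nat.Properties using (_<?_)
open import Data.Fin as Fin using (Fin; toℕ; splitAt)
open import Data.Fin.Properties using () renaming (_≟_ to _≟ᶠ_)
open import Data.Bool using (Bool; true; false; if_then_else_; _∧_; _xor_)
open import Data.Vec using (Vec; tabulate; zipWith; foldr; lookup)
open import Data.Sum using (_⊎_; inj₁; inj₂)
open import Data.Product using (Σ; ∃; _×_; _,_)
open import Relation.Nullary using (¬_; does)
open import Relation.Binary.PropositionalEquality using (_≡_; _≢_)
open import Relation.Binary.Definitions using (DecidableEquality)
open import Algebra.Structures using (IsCommutativeRing)
open import Function.Bundles using (_↔_)

record FiniteField (r : ℕ) : Set₁ where
  infixl 6 _+_
  infixl 7 _*_
  field
    Carrier   : Set
    _+_ _*_   : Carrier → Carrier → Carrier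
    -_        : Carrier → Carrier
    0# 1#     : Carrier
    isCommutativeRing : IsCommutativeRing _≡_ _+_ _*_ -_ 0# 1#
    0≢1       : 0# ≢ 1#
    inverse   : ∀ x → x ≢ 0# → ∃ λ y → x * y ≡ 1#
    _≟_       : DecidableEquality Carrier
    enumeration : Fin (2 ^ r) ↔ Carrier

-- 2n = (n-1) + (n-1) + 2 for n = suc m
dim : ℕ → ℕ
dim m = (m ℕ.+ m) ℕ.+ 2

data Sign : Set where
  plus minus : Sign

data DCIndex : Set where
  i1 i2 i3 i4 : DCIndex

module OverField {r : ℕ} (F : FiniteField r) (κ : FiniteField.Carrier F) where
  open FiniteField F

  -- z^2 + z + κ is irreducible: it is not a product (z + a)(z + b).
  IrreducibleZ2+Z+κ : Set
  IrreducibleZ2+Z+κ = ¬ (Σ Carrier λ a → Σ Carrier λ b → (a + b ≡ 1#) × (a * b ≡ κ))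

  pow : Carrier → ℕ → Carrier
  pow x zero    = 1#
  pow x (suc k) = x * pow x k

  ∑ : ∀ {k} → (Fin k → Carrier) → Carrier
  ∑ {zero}  f = 0#
  ∑ {suc k} f = f Fin.zero + ∑ (λ j → f (Fin.suc j))

  tr : Carrier → Carrier
  tr x = ∑ {r} (λ j → pow x (2 ^ toℕ j))

  -- F_2 = {0,1} ⊆ F_q is identified with Bool (1 ↦ true, 0 ↦ false)
  toBit : Carrier → Bool
  toBit x = does (x ≟ 1#)

  Mat : ℕ → ℕ → Set
  Mat a b = Fin a → Fin b → Carrier

  infixl 7 _⊗_
  _⊗_ : ∀ {a b c} → Mat a b → Mat b c → Mat a c
  (A ⊗ B) i k = ∑ (λ j → A i j * B j k)

  ᵗ : ∀ {a b} → Mat a b → Mat b a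
  ᵗ A i j = A j i

  δᵢⱼ : ∀ {a} → Fin a → Fin a → Carrier
  δᵢⱼ i j = if does (i ≟ᶠ j) then 1# else 0#

  𝟙 : ∀ {a} → Mat a a
  𝟙 = δᵢⱼ

  𝟘 : ∀ {a b} → Mat a b
  𝟘 _ _ = 0#

  infix 4 _≐_
  _≐_ : ∀ {a b} → Mat a b → Mat a b → Set
  A ≐ B = ∀ i j → A i j ≡ B i j

  Tr : ∀ {a} → Mat a a → Carrier
  Tr A = ∑ (λ i → A i i)

  Alternating : ∀ {a} → Mat a a → Set
  Alternating A = (∀ i j → A i j ≡ A j i) × (∀ i → A i i ≡ 0#)

  Invertible : ∀ {a} → Mat a a → Mat a a → Set
  Invertible A A' = (A ⊗ A' ≐ 𝟙) × (A' ⊗ A ≐ 𝟙)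

  mat2 : Carrier → Carrier → Carrier → Carrier → Mat 2 2
  mat2 a b c d Fin.zero    Fin.zero    = a
  mat2 a b c d Fin.zero    (Fin.suc _) = b
  mat2 a b c d (Fin.suc _) Fin.zero    = c
  mat2 a b c d (Fin.suc _) (Fin.suc _) = d

  δ η : Mat 2 2
  δ = mat2 1# 1# 0# κ
  η = mat2 0# 1# 1# 0#

  InSO⁻₂ : Mat 2 2 → Set
  InSO⁻₂ i = Σ Carrier λ d₁ → Σ Carrier λ d₂ →
    (d₁ * d₁ + d₁ * d₂ + κ * d₂ * d₂ ≡ 1#) × (i ≐ mat2 d₁ (κ * d₂) d₂ (d₁ + d₂))

  data Part (m : ℕ) : Set where
    first second : Fin m → Part m
    third        : Fin 2 → Part m

  part : ∀ m → Fin (dim m) → Part m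
  part m k with splitAt (m ℕ.+ m) k
  ... | inj₂ c = third c
  ... | inj₁ k' with splitAt m k'
  ...   | inj₁ a = first a
  ...   | inj₂ b = second b

  blocks : ∀ m →
    Mat m m → Mat m m → Mat m 2 →
    Mat m m → Mat m m → Mat m 2 →
    Mat 2 m → Mat 2 m → Mat 2 2 → Mat (dim m) (dim m)
  blocks m X₁₁ X₁₂ X₁₃ X₂₁ X₂₂ X₂₃ X₃₁ X₃₂ X₃₃ k l with part m k | part m l
  ... | first a  | first b  = X₁₁ a b
  ... | first a  | second b = X₁₂ a b
  ... | first a  | third b  = X₁₃ a b
  ... | second a | first b  = X₂₁ a b
  ... | second a | second b = X₂₂ a b
  ... | second a | third b  = X₂₃ a b
  ... | third a  | first b  = X₃₁ a b
  ... | third a  | second b = X₃₂ a b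
  ... | third a  | third b  = X₃₃ a b

  -- the generic element of Q, with A' = A⁻¹
  qElem : ∀ m → Mat m m → Mat m m → Mat 2 2 → Mat m m → Mat 2 m → Mat (dim m) (dim m)
  qElem m A A' i B h =
    blocks m A 𝟘 𝟘  𝟘 (ᵗ A') 𝟘  𝟘 𝟘 i
    ⊗ blocks m 𝟙 B (ᵗ h ⊗ ᵗ i ⊗ η ⊗ i)  𝟘 𝟙 𝟘  𝟘 h 𝟙

  InQ : ∀ m → Mat (dim m) (dim m) → Set
  InQ m g =
    Σ (Mat m m) λ A → Σ (Mat m m) λ A' → Σ (Mat 2 2) λ i →
    Σ (Mat m m) λ B → Σ (Mat 2 m) λ h →
      Invertible A A' × InSO⁻₂ i × Alternating (ᵗ B ℕ+ᴹ (ᵗ h ⊗ δ ⊗ h))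
      × (g ≐ qElem m A A' i B h)
    where
    _ℕ+ᴹ_ : Mat m m → Mat m m → Mat m m
    (X ℕ+ᴹ Y) a b = X a b + Y a b

  ρ : ∀ m → Mat (dim m) (dim m)
  ρ m = blocks m 𝟙 𝟘 𝟘  𝟘 𝟙 𝟘  𝟘 𝟘 (mat2 1# 1# 0# 1#)

  -- σ_s: permutation matrix interchanging e^j and e^{n-1+j} for 1 ≤ j ≤ s
  σ : ∀ m → ℕ → Mat (dim m) (dim m)
  σ m s k l with part m k | part m l
  ... | first a  | first b  = if does (toℕ a <? s) then 0# else δᵢⱼ a b
  ... | second a | second b = if does (toℕ a <? s) then 0# else δᵢⱼ a b
  ... | first a  | second b = if does (toℕ a <? s) then δᵢⱼ a b else 0#
  ... | second a | first b  = if does (toℕ a <? s) then δᵢⱼ a b else 0#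
  ... | third a  | third b  = δᵢⱼ a b
  ... | _        | _        = 0#

  InXQσQ : ∀ m → Mat (dim m) (dim m) → ℕ → Mat (dim m) (dim m) → Set
  InXQσQ m X s g = Σ (Mat (dim m) (dim m)) λ q₁ → Σ (Mat (dim m) (dim m)) λ q₂ →
    InQ m q₁ × InQ m q₂ × (g ≐ X ⊗ q₁ ⊗ σ m s ⊗ q₂)

  -- DC_i^ε(n,q) for n = suc m (membership predicate); n-1 = m
  DC : Sign → DCIndex → (m : ℕ) → Mat (dim m) (dim m) → Set
  DC plus  i1 m = InXQσQ m 𝟙 m
  DC plus  i2 m = InXQσQ m 𝟙 (m ∸ 1)
  DC plus  i3 m = InXQσQ m (ρ m) (m ∸ 1)
  DC plus  i4 m = InXQσQ m (ρ m) (m ∸ 2)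
  DC minus i1 m = InXQσQ m 𝟙 m
  DC minus i2 m = InXQσQ m 𝟙 (m ∸ 1)
  DC minus i3 m = InXQσQ m (ρ m) (m ∸ 1)
  DC minus i4 m = InXQσQ m (ρ m) (m ∸ 2)

  Enumerates : ∀ {d N} → (Mat d d → Set) → (Fin N → Mat d d) → Set
  Enumerates {d} {N} D gs =
    (∀ (g : Mat d d) → D g → ∃ λ k → g ≐ gs k)
    × (∀ k → D (gs k))
    × (∀ k l → gs k ≐ gs l → k ≡ l)

  InC : ∀ {d N} → (Fin N → Mat d d) → Vec Bool N → Set
  InC gs u = ∑ (λ k → if lookup u k then Tr (gs k) else 0#) ≡ 0#

  dot : ∀ {N} → Vec Bool N → Vec Bool N → Bool
  dot u v = foldr _ _xor_ false (zipWith _∧_ u v)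

  InC⊥ : ∀ {d N} → (Fin N → Mat d d) → Vec Bool N → Set
  InC⊥ {N = N} gs v = ∀ (u : Vec Bool N) → InC gs u → dot u v ≡ false

  cw : ∀ {d N} → (Fin N → Mat d d) → Carrier → Vec Bool N
  cw gs a = tabulate (λ k → toBit (tr (a * Tr (gs k))))

  IsLinearIsoOntoC⊥ : ∀ {d N} → (Fin N → Mat d d) → Set
  IsLinearIsoOntoC⊥ gs =
    (∀ a → InC⊥ gs (cw gs a))
    × (∀ a b → cw gs (a + b) ≡ zipWith _xor_ (cw gs a) (cw gs b))
    × (∀ a b → cw gs a ≡ cw gs b → a ≡ b)
    × (∀ v → InC⊥ gs v → ∃ λ a → cw gs a ≡ v)

Odd : ℕ → Set
Odd n = ¬ (2 ∣ n)

Cases : Sign → DCIndex → (n r : ℕ) → Set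
Cases plus  i1 n r = 2 ≤ n × 2 ∣ n
Cases plus  i2 n r = 2 ≤ n × 2 ∣ n
Cases plus  i3 n r = (4 ≤ n × 2 ∣ n) ⊎ (n ≡ 2 × 8 ≤ 2 ^ r)
Cases plus  i4 n r = 4 ≤ n × 2 ∣ n
Cases minus i1 n r = 1 ≤ n × Odd n
Cases minus i2 n r = 3 ≤ n × Odd n
Cases minus i3 n r = 3 ≤ n × Odd n
Cases minus i4 n r = (5 ≤ n × Odd n) ⊎ (n ≡ 3 × 4 ≤ 2 ^ r)

{-# OPTIONS --safe #-}

-- Solving the linear system tr (a Tr g_k) = v_k over F₂, or exhibiting a relation u ∈ C(D) with
-- u · v = 1, shows that a ↦ c(a) is always onto C(D)^⊥ (Delsarte). Injectivity says that no nonzero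
-- functional tr (b _) kills all the traces Tr g. Elements of the form X σ_s q with q ∈ Q suffice:
-- for s ≥ 1 they realise every square, hence all of F_q; for s = 0 they realise the traces d₂ of
-- SO⁻(2,q) (X = 1), the a + 1/a (X = ρ, n = 2), or everything (X = ρ, n = 3, q ≥ 4), and
-- the first two sets are handled by counting and by Hua's identity.
module Submission where

open import Defs
open import Algebra.Bundles using (CommutativeRing; RawRing)
open import Algebra.Solver.Ring.AlmostCommutativeRing using (fromCommutativeSemiring; _-Raw-AlmostCommutative⟶_)
open import Data.Bool using (Bool; true; false; if_then_else_; _∧_; _xor_)
open import Data.Bool.Properties using (xor-same; xor-identityʳ)
open import Data.Empty using (⊥-elim)
open import Data.Fin as Fin using (Fin; toℕ; _↑ˡ_; _↑ʳ_)
open import Data.Fin.Permutation using (permutation)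
open import Data.Fin.Properties using (any?; ¬∀⟶∃¬; punchInᵢ≢i; splitAt-↑ˡ; splitAt-↑ʳ; suc-injective; inject≤-injective; injective⇒≤) renaming (_≟_ to _≟ᶠ_)
open import Data.Maybe using (Maybe; just; nothing)
open import Data.Nat as ℕ using (ℕ; zero; suc; _^_; _≤_; _<_; _∸_; z≤n; s≤s)
open import Data.Nat.Properties using (<⇒≱; ≤⇒≤′; ^-monoʳ-<; n<1+n; +-identityʳ; ≤-trans; ≤-refl; _<?_; m^n≢0; m∸n≤m)
open import Data.Product using (∃; _×_; _,_; proj₁; proj₂)
open import Data.Sum using (_⊎_; inj₁; inj₂)
open import Data.Vec using (Vec; []; _∷_; tabulate; zipWith; lookup)
open import Data.Vec.Properties using (tabulate-cong; lookup∘tabulate)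
open import Data.Unit using (⊤; tt)
open import Function using (_∘_; _⟨_⟩_)
open import Function.Bundles using (Inverse)
open import Level using (0ℓ)
open import Relation.Nullary using (¬_; does; yes; no; contradiction)
open import Relation.Binary.PropositionalEquality
import Algebra.Properties.CommutativeMonoid.Sum as MonoidSum
import Algebra.Properties.Semiring.Mult as Mult
import Algebra.Solver.Ring as RingSolver

-- A separating subset makes every larger set of traces separating. So neither the size of a double
-- coset nor the distribution of its traces is computed, and the left factor from `Q` can be fixed
-- as the identity. The bounds on q come from `X = ρ` with s = 0. There the 2 × 2 block has trace 0,
-- and only Tr A + Tr A⁻¹ remains. For n = 2 this is a + 1/a. It is always 0 when q = 2, and when q
-- = 4 it takes only the values 0 and 1, both killed by tr because tr 1 = 0 in F₄. For n = 3 and q =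
-- 2 every determinant is 1, so t (1 + 1/d) vanishes identically. A `FiniteField` is given only as a
-- field with an enumeration of length 2^r. Characteristic 2, x^q = x and the nonvanishing of the
-- trace are therefore derived here: the first two by permuting the elements, the last by counting
-- roots.

module OverFiniteField {r : ℕ} (F : FiniteField r) (κ : FiniteField.Carrier F) where
  open FiniteField F
  open OverField F κ
  open ≡-Reasoning

  -- Field arithmetic: reindexing, characteristic 2, and x^q = x.

  commutativeRing : CommutativeRing 0ℓ 0ℓ
  commutativeRing = record { isCommutativeRing = isCommutativeRing }

  open CommutativeRing commutativeRing
    using (+-commutativeMonoid; *-commutativeMonoid; commutativeSemiring; semiring
          ; +-assoc; +-comm; *-assoc; *-comm; *-identityˡ; *-identityʳ; zeroˡ; zeroʳ
          ; +-identityˡ; distribˡ; distribʳ; -‿inverseʳ; +-group)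
    renaming (+-identityʳ to +#-identityʳ)
    public

  open import Algebra.Properties.Group +-group using (∙-cancelˡ)

  module Sum = MonoidSum +-commutativeMonoid
  module Product = MonoidSum *-commutativeMonoid
  open Mult semiring using (×1-homo-*) renaming (_×_ to _·_)

  element : Fin (2 ^ r) → Carrier
  element = Inverse.to enumeration

  index : Carrier → Fin (2 ^ r)
  index = Inverse.from enumeration

  element-index : ∀ x → element (index x) ≡ x
  element-index = Inverse.strictlyInverseˡ enumeration

  index-element : ∀ i → index (element i) ≡ i
  index-element = Inverse.strictlyInverseʳ enumeration

  element-injective : ∀ {i j} → element i ≡ element j → i ≡ j
  element-injective eq = trans (sym (index-element _)) (trans (cong index eq) (index-element _))

  index-injective : ∀ {x y} → index x ≡ index y → x ≡ y
  index-injective eq = trans (sym (element-index _)) (trans (cong element eq) (element-index _))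

  private
    perm : (f g : Carrier → Carrier) → (∀ x → f (g x) ≡ x) → (∀ x → g (f x) ≡ x) → _
    perm f g fg gf = permutation (index ∘ f ∘ element) (index ∘ g ∘ element)
      (λ i → trans (cong (index ∘ f) (element-index _)) (trans (cong index (fg _)) (index-element i)))
      (λ i → trans (cong (index ∘ g) (element-index _)) (trans (cong index (gf _)) (index-element i)))

  sum-reindex : ∀ (h f g : Carrier → Carrier) → (∀ x → f (g x) ≡ x) → (∀ x → g (f x) ≡ x) →
    Sum.sum (h ∘ element) ≡ Sum.sum (h ∘ f ∘ element)
  sum-reindex h f g fg gf = trans (Sum.sum-permute (h ∘ element) (perm f g fg gf))
    (Sum.sum-cong-≗ {2 ^ r} (λ i → cong h (element-index (f (element i)))))

  product-reindex : ∀ (h f g : Carrier → Carrier) → (∀ x → f (g x) ≡ x) → (∀ x → g (f x) ≡ x) →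
    Product.sum (h ∘ element) ≡ Product.sum (h ∘ f ∘ element)
  product-reindex h f g fg gf = trans (Product.sum-permute (h ∘ element) (perm f g fg gf))
    (Product.sum-cong-≗ {2 ^ r} (λ i → cong h (element-index (f (element i)))))

  *-cancelˡ-≢0 : ∀ {a x y} → a ≢ 0# → a * x ≡ a * y → x ≡ y
  *-cancelˡ-≢0 {a} {x} {y} a≢0 eq = begin
    x            ≡⟨ back x ⟨
    b * (a * x)  ≡⟨ cong (b *_) eq ⟩
    b * (a * y)  ≡⟨ back y ⟩
    y            ∎
    where
    b = proj₁ (inverse a a≢0)
    back : ∀ z → b * (a * z) ≡ z
    back z = trans (sym (*-assoc b a z))
      (trans (cong (_* z) (trans (*-comm b a) (proj₂ (inverse a a≢0)))) (*-identityˡ z))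

  x*y≡0⇒y≡0 : ∀ {x y} → x ≢ 0# → x * y ≡ 0# → y ≡ 0#
  x*y≡0⇒y≡0 x≢0 eq = *-cancelˡ-≢0 x≢0 (trans eq (sym (zeroʳ _)))

  x*y≢0 : ∀ {x y} → x ≢ 0# → y ≢ 0# → x * y ≢ 0#
  x*y≢0 x≢0 y≢0 eq = y≢0 (x*y≡0⇒y≡0 x≢0 eq)

  x*y≡1⇒x≢0 : ∀ {x y} → x * y ≡ 1# → x ≢ 0#
  x*y≡1⇒x≢0 eq refl = 0≢1 (trans (sym (zeroˡ _)) eq)

  -- Translation by 1 permutes F, so comparing the sums of all elements gives q · 1 = 0.
  q·1≡0 : (2 ^ r) · 1# ≡ 0#
  q·1≡0 = sym (∙-cancelˡ total _ _ (begin
    total + 0#                          ≡⟨ +#-identityʳ total ⟩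
    total                               ≡⟨ sum-reindex (λ x → x) (_+ 1#) (_+ - 1#)
                                             (λ x → cancel x (trans (+-comm _ _) (-‿inverseʳ 1#)))
                                             (λ x → cancel x (-‿inverseʳ 1#)) ⟩
    Sum.sum (λ i → element i + 1#)      ≡⟨ Sum.∑-distrib-+ element (λ _ → 1#) ⟩
    total + Sum.sum {2 ^ r} (λ _ → 1#)  ≡⟨ cong (total +_) (Sum.sum-replicate (2 ^ r)) ⟩
    total + (2 ^ r) · 1#                ∎))
    where
    total = Sum.sum element
    cancel : ∀ x {a b} → a + b ≡ 0# → (x + a) + b ≡ x
    cancel x eq = trans (+-assoc x _ _) (trans (cong (x +_) eq) (+#-identityʳ x))

  -- The multiple 2^r · 1 is (1 + 1)^r, and a field has no zero divisors, so `q·1≡0` forces the base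
  -- to vanish.
  1+1≡0 : 1# + 1# ≡ 0#
  1+1≡0 with (1# + 1#) ≟ 0#
  ... | yes eq = eq
  ... | no ≢0 = ⊥-elim (power≢0 r q·1≡0)
    where
    power≢0 : ∀ k → (2 ^ k) · 1# ≢ 0#
    power≢0 zero    eq = 0≢1 (sym (trans (sym (+#-identityʳ 1#)) eq))
    power≢0 (suc k) eq = x*y≢0 (λ e → ≢0 (trans (cong (1# +_) (sym (+#-identityʳ 1#))) e)) (power≢0 k)
      (trans (sym (×1-homo-* 2 (2 ^ k))) eq)

  -- Taking F₂ as the coefficient ring lets the solver cancel x + x.
  module Char2Solver where
    bit : Bool → Carrier
    bit true  = 1#
    bit false = 0#

    coefficients : RawRing 0ℓ 0ℓ
    coefficients = record
      { Carrier = Bool ; _≈_ = _≡_ ; _+_ = _xor_ ; _*_ = _∧_ ; -_ = λ x → x ; 0# = false ; 1# = true }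

    homomorphism : coefficients -Raw-AlmostCommutative⟶ fromCommutativeSemiring commutativeSemiring
    homomorphism = record
      { ⟦_⟧ = bit
      ; +-homo = λ { true true → sym 1+1≡0 ; true false → sym (+#-identityʳ 1#) ; false y → sym (+-identityˡ _) }
      ; *-homo = λ { true y → sym (*-identityˡ _) ; false y → sym (zeroˡ _) }
      ; -‿homo = λ _ → refl ; 0-homo = refl ; 1-homo = refl }

    dec : (x y : Bool) → Maybe (bit x ≡ bit y)
    dec true  true  = just refl
    dec false false = just refl
    dec _     _     = nothing

    open RingSolver coefficients (fromCommutativeSemiring commutativeSemiring) homomorphism dec public
      using (solve; _:=_; _:+_; _:*_; con)

  open Char2Solver public

  x+x≡0 : ∀ x → x + x ≡ 0#
  x+x≡0 = solve 1 (λ x → x :+ x := con false) refl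

  x+y≡0⇒x≡y : ∀ {x y} → x + y ≡ 0# → x ≡ y
  x+y≡0⇒x≡y {x} {y} eq = trans (solve 2 (λ x y → x := (x :+ y) :+ y) refl x y)
    (trans (cong (_+ y) eq) (+-identityˡ y))

  product≢0 : ∀ {n} (t : Fin n → Carrier) → (∀ i → t i ≢ 0#) → Product.sum t ≢ 0#
  product≢0 {zero}  t nz eq = 0≢1 (sym eq)
  product≢0 {suc n} t nz = x*y≢0 (nz Fin.zero) (product≢0 (t ∘ Fin.suc) (nz ∘ Fin.suc))

  product-single : ∀ {n} (t : Fin n → Carrier) i → (∀ j → j ≢ i → t j ≡ 1#) → Product.sum t ≡ t i
  product-single {suc n} t i ones = begin
    Product.sum t                                      ≡⟨ Product.sum-remove t ⟩
    t i * Product.sum (λ j → t (Fin.punchIn i j))      ≡⟨ cong (t i *_) (Product.sum-cong-≗ (λ j → ones _ (punchInᵢ≢i i j))) ⟩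
    t i * Product.sum {n} (λ _ → 1#)                   ≡⟨ cong (t i *_) (Product.sum-replicate-zero n) ⟩
    t i * 1#                                           ≡⟨ *-identityʳ _ ⟩
    t i                                                ∎

  product-const : ∀ n a → Product.sum {n} (λ _ → a) ≡ pow a n
  product-const zero    a = refl
  product-const (suc n) a = cong (a *_) (product-const n a)

  pow-0 : ∀ n → .{{ℕ.NonZero n}} → pow 0# n ≡ 0#
  pow-0 (suc n) = zeroˡ _

  -- Multiplication by a ≠ 0 permutes F; the products are taken over x with 0 replaced by 1.
  x^q≡x : ∀ a → pow a (2 ^ r) ≡ a
  x^q≡x a with a ≟ 0#
  ... | yes refl = pow-0 (2 ^ r) {{m^n≢0 2 r}}
  ... | no a≢0 = *-cancelˡ-≢0 P≢0 (begin
      P * pow a (2 ^ r)                                   ≡⟨ *-comm _ _ ⟩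
      pow a (2 ^ r) * P                                   ≡⟨ cong (_* P) (product-const (2 ^ r) a) ⟨
      Product.sum {2 ^ r} (λ _ → a) * P                   ≡⟨ Product.∑-distrib-+ (λ _ → a) (g ∘ element) ⟨
      Product.sum (λ i → a * g (element i))               ≡⟨ Product.sum-cong-≗ (λ i → shift (element i)) ⟩
      Product.sum (λ i → g (a * element i) * h (element i)) ≡⟨ Product.∑-distrib-+ (g ∘ (a *_) ∘ element) (h ∘ element) ⟩
      Product.sum (g ∘ (a *_) ∘ element) * Product.sum (h ∘ element)
        ≡⟨ cong₂ _*_ (sym (product-reindex g (a *_) (a' *_) (back aa') (back (trans (*-comm a' a) aa')))) Πh ⟩
      P * a                                               ∎)
    where
    a' = proj₁ (inverse a a≢0)
    aa' = proj₂ (inverse a a≢0)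
    g h : Carrier → Carrier
    g x = if does (x ≟ 0#) then 1# else x
    -- At x = 0 the product of all `a * g x` contains one surplus factor `a`, which `h` records.
    -- This yields a^q = a directly instead of a^(q-1) = 1.
    h x = if does (x ≟ 0#) then a else 1#
    P = Product.sum (g ∘ element)
    g≢0 : ∀ x → g x ≢ 0#
    g≢0 x with x ≟ 0#
    ... | yes _ = λ eq → 0≢1 (sym eq)
    ... | no x≢0 = x≢0
    P≢0 : P ≢ 0#
    P≢0 = product≢0 (g ∘ element) (g≢0 ∘ element)
    back : ∀ {u v} → u * v ≡ 1# → ∀ x → u * (v * x) ≡ x
    back eq x = trans (sym (*-assoc _ _ _)) (trans (cong (_* x) eq) (*-identityˡ x))
    shift : ∀ x → a * g x ≡ g (a * x) * h x
    shift x with x ≟ 0# | (a * x) ≟ 0#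
    ... | yes _    | yes _  = trans (*-identityʳ a) (sym (*-identityˡ a))
    ... | yes refl | no  ≢0 = contradiction (zeroʳ a) ≢0
    ... | no x≢0   | yes ≡0 = contradiction ≡0 (x*y≢0 a≢0 x≢0)
    ... | no _     | no _   = sym (*-identityʳ _)
    h-0 : ∀ x → x ≡ 0# → h x ≡ a
    h-0 x eq with x ≟ 0#
    ... | yes _ = refl
    ... | no ≢0 = contradiction eq ≢0
    h-≢0 : ∀ x → x ≢ 0# → h x ≡ 1#
    h-≢0 x ≢0 with x ≟ 0#
    ... | yes eq = contradiction eq ≢0
    ... | no _ = refl
    Πh : Product.sum (h ∘ element) ≡ a
    Πh = trans (product-single (h ∘ element) (index 0#)
           (λ j j≢ → h-≢0 _ (λ eq → j≢ (trans (sym (index-element j)) (cong index eq)))))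
         (h-0 _ (element-index 0#))

  -- Frobenius, finite sums, and the trace to F₂.

  pow-+ : ∀ x m n → pow x (m ℕ.+ n) ≡ pow x m * pow x n
  pow-+ x zero    n = sym (*-identityˡ _)
  pow-+ x (suc m) n = trans (cong (x *_) (pow-+ x m n)) (sym (*-assoc _ _ _))

  pow-2^suc : ∀ x k → pow x (2 ^ suc k) ≡ pow x (2 ^ k) * pow x (2 ^ k)
  pow-2^suc x k = trans (cong (λ n → pow x (2 ^ k ℕ.+ n)) (+-identityʳ (2 ^ k))) (pow-+ x (2 ^ k) (2 ^ k))

  frobenius-+ : ∀ x y k → pow (x + y) (2 ^ k) ≡ pow x (2 ^ k) + pow y (2 ^ k)
  frobenius-+ x y zero    = distribʳ 1# x y
  frobenius-+ x y (suc k) = begin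
    pow (x + y) (2 ^ suc k)                            ≡⟨ pow-2^suc (x + y) k ⟩
    pow (x + y) (2 ^ k) * pow (x + y) (2 ^ k)          ≡⟨ cong (λ z → z * z) (frobenius-+ x y k) ⟩
    (X + Y) * (X + Y)                                  ≡⟨ solve 2 (λ x y → (x :+ y) :* (x :+ y) := x :* x :+ y :* y) refl X Y ⟩
    X * X + Y * Y                                      ≡⟨ cong₂ _+_ (pow-2^suc x k) (pow-2^suc y k) ⟨
    pow x (2 ^ suc k) + pow y (2 ^ suc k)              ∎
    where
    X = pow x (2 ^ k)
    Y = pow y (2 ^ k)

  ∑-cong : ∀ {n} {f g : Fin n → Carrier} → (∀ i → f i ≡ g i) → ∑ f ≡ ∑ g
  ∑-cong {zero}  eq = refl
  ∑-cong {suc n} eq = cong₂ _+_ (eq Fin.zero) (∑-cong (eq ∘ Fin.suc))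

  ∑-+ : ∀ {n} (f g : Fin n → Carrier) → ∑ (λ i → f i + g i) ≡ ∑ f + ∑ g
  ∑-+ {zero}  f g = sym (+-identityˡ 0#)
  ∑-+ {suc n} f g = trans (cong (f Fin.zero + g Fin.zero +_) (∑-+ (f ∘ Fin.suc) (g ∘ Fin.suc)))
    (solve 4 (λ a b c d → (a :+ b) :+ (c :+ d) := (a :+ c) :+ (b :+ d)) refl _ _ _ _)

  ∑-zero : ∀ {n} (f : Fin n → Carrier) → (∀ i → f i ≡ 0#) → ∑ f ≡ 0#
  ∑-zero {zero}  f z = refl
  ∑-zero {suc n} f z = trans (cong₂ _+_ (z Fin.zero) (∑-zero (f ∘ Fin.suc) (z ∘ Fin.suc))) (+-identityˡ 0#)

  ∑-snoc : ∀ (f : ℕ → Carrier) k → ∑ {suc k} (f ∘ toℕ) ≡ ∑ {k} (f ∘ toℕ) + f k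
  ∑-snoc f zero    = +-comm _ _
  ∑-snoc f (suc k) = trans (cong (f 0 +_) (∑-snoc (f ∘ suc) k)) (sym (+-assoc _ _ _))

  ∑-square : ∀ {n} (f : Fin n → Carrier) → ∑ f * ∑ f ≡ ∑ (λ i → f i * f i)
  ∑-square {zero}  f = zeroˡ 0#
  ∑-square {suc n} f = trans
    (solve 2 (λ x y → (x :+ y) :* (x :+ y) := x :* x :+ y :* y) refl (f Fin.zero) (∑ (f ∘ Fin.suc)))
    (cong (f Fin.zero * f Fin.zero +_) (∑-square (f ∘ Fin.suc)))

  tr-+ : ∀ x y → tr (x + y) ≡ tr x + tr y
  tr-+ x y = trans (∑-cong {r} (λ j → frobenius-+ x y (toℕ j))) (∑-+ {r} _ _)

  -- Squaring moves each conjugate x^(2^j) to the next one, and the last returns to x by `x^q≡x`; so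
  -- the square is the same sum, cyclically shifted.
  tr-idempotent : ∀ x → tr x * tr x ≡ tr x
  tr-idempotent x = x+y≡0⇒x≡y (begin
    tr x * tr x + tr x        ≡⟨ cong (_+ tr x) (∑-square {r} (conj ∘ toℕ)) ⟩
    ∑ {r} (λ j → conj (toℕ j) * conj (toℕ j)) + tr x
                              ≡⟨ cong (_+ tr x) (∑-cong {r} (λ j → sym (pow-2^suc x (toℕ j)))) ⟩
    S + tr x                  ≡⟨ solve 3 (λ x s t → s :+ t := x :+ (x :+ s) :+ t) refl x S (tr x) ⟩
    x + (x + S) + tr x        ≡⟨ cong (λ z → x + (z + S) + tr x) (*-identityʳ x) ⟨
    x + (conj 0 + S) + tr x   ≡⟨ cong (λ z → x + z + tr x) (∑-snoc conj r) ⟩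
    x + (tr x + conj r) + tr x ≡⟨ cong (λ z → x + (tr x + z) + tr x) (x^q≡x x) ⟩
    x + (tr x + x) + tr x     ≡⟨ solve 2 (λ x t → x :+ (t :+ x) :+ t := con false) refl x (tr x) ⟩
    0#                        ∎)
    where
    conj : ℕ → Carrier
    conj j = pow x (2 ^ j)
    S = ∑ {r} (λ j → conj (suc (toℕ j)))

  tr∈F₂ : ∀ x → tr x ≡ 0# ⊎ tr x ≡ 1#
  tr∈F₂ x with tr x ≟ 0#
  ... | yes ≡0 = inj₁ ≡0
  ... | no ≢0 = inj₂ (*-cancelˡ-≢0 ≢0 (trans (tr-idempotent x) (sym (*-identityʳ _))))

  τ : Carrier → Bool
  τ x = toBit (tr x)

  toBit-0 : toBit 0# ≡ false
  toBit-0 with 0# ≟ 1#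
  ... | yes eq = contradiction eq 0≢1
  ... | no _   = refl

  toBit-1 : toBit 1# ≡ true
  toBit-1 with 1# ≟ 1#
  ... | yes _ = refl
  ... | no ≢  = contradiction refl ≢

  τ-+ : ∀ x y → τ (x + y) ≡ τ x xor τ y
  τ-+ x y rewrite tr-+ x y with tr x | tr y | tr∈F₂ x | tr∈F₂ y
  ... | _ | b | inj₁ refl | _ rewrite toBit-0 = cong toBit (+-identityˡ b)
  ... | _ | _ | inj₂ refl | inj₁ refl rewrite toBit-0 | toBit-1 = trans (cong toBit (+#-identityʳ 1#)) toBit-1
  ... | _ | _ | inj₂ refl | inj₂ refl rewrite toBit-1 = trans (cong toBit 1+1≡0) toBit-0

  τ-0 : τ 0# ≡ false
  τ-0 with τ 0# | τ-+ 0# 0# | cong τ (+-identityˡ 0#)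
  ... | false | _  | _ = refl
  ... | true  | e1 | e2 = trans (sym e2) e1

  -- Polynomial functions and the bound on their roots.

  -- Poly ℓ d f: f is a polynomial function of degree at most d whose coefficient at x^d is ℓ.
  data Poly (ℓ : Carrier) : ℕ → (Carrier → Carrier) → Set where
    const  : ∀ {f} → (∀ x → f x ≡ ℓ) → Poly ℓ 0 f
    horner : ∀ {d f g} c → Poly ℓ d g → (∀ x → f x ≡ c + x * g x) → Poly ℓ (suc d) f

  poly-cong : ∀ {ℓ d f g} → (∀ x → g x ≡ f x) → Poly ℓ d f → Poly ℓ d g
  poly-cong eq (const p)      = const (λ x → trans (eq x) (p x))
  poly-cong eq (horner c p e) = horner c p (λ x → trans (eq x) (e x))

  poly-+ : ∀ {a b d f g} → Poly a d f → Poly b d g → Poly (a + b) d (λ x → f x + g x)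
  poly-+ (const p) (const q) = const (λ x → cong₂ _+_ (p x) (q x))
  poly-+ (horner c p e) (horner c' p' e') = horner (c + c') (poly-+ p p') (λ x → trans (cong₂ _+_ (e x) (e' x))
    (solve 5 (λ c c' x g g' → (c :+ x :* g) :+ (c' :+ x :* g') := c :+ c' :+ x :* (g :+ g')) refl _ _ _ _ _))

  poly-scale : ∀ {ℓ d f} a → Poly ℓ d f → Poly (a * ℓ) d (λ x → a * f x)
  poly-scale a (const p) = const (λ x → cong (a *_) (p x))
  poly-scale a (horner c p e) = horner (a * c) (poly-scale a p) (λ x → trans (cong (a *_) (e x))
    (solve 4 (λ a c x g → a :* (c :+ x :* g) := a :* c :+ x :* (a :* g)) refl _ _ _ _))

  -- Padding with a zero top coefficient lets a function of lower degree be added without disturbing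
  -- the leading coefficient.
  poly-raise : ∀ {ℓ d f} → Poly ℓ d f → Poly 0# (suc d) f
  poly-raise {ℓ} (const p) = horner ℓ (const {f = λ _ → 0#} (λ _ → refl))
    (λ x → trans (p x) (solve 2 (λ l x → l := l :+ x :* con false) refl ℓ x))
  poly-raise (horner c p e) = horner c (poly-raise p) e

  poly-raise-≤ : ∀ {ℓ d e f} → d < e → Poly ℓ d f → Poly 0# e f
  poly-raise-≤ d<e p = go (≤⇒≤′ d<e) p
    where
    go : ∀ {ℓ d e f} → suc d ℕ.≤′ e → Poly ℓ d f → Poly 0# e f
    go ℕ.≤′-refl     p = poly-raise p
    go (ℕ.≤′-step l) p = poly-raise (go l p)

  poly-pow : ∀ d → Poly 1# d (λ x → pow x d)
  poly-pow zero    = const (λ _ → refl)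
  poly-pow (suc d) = horner 0# (poly-pow d) (λ x → sym (+-identityˡ _))

  -- Synthetic division by recursion on the Horner form. If f = c + x g and g = g(a) + (x + a) g',
  -- then f = f(a) + (x + a)(g + a g'), and a g' has smaller degree than g, so the leading
  -- coefficient survives.
  poly-divide : ∀ {ℓ d f} → Poly ℓ (suc d) f → ∀ a →
    ∃ λ g → Poly ℓ d g × (∀ x → f x ≡ f a + (x + a) * g x)
  poly-divide {ℓ} {f = f} (horner {g = g} c (const p) e) a = g , const p , λ x → begin
    f x                        ≡⟨ e x ⟩
    c + x * g x                ≡⟨ solve 4 (λ c x a g → c :+ x :* g := c :+ a :* g :+ (x :+ a) :* g) refl c x a (g x) ⟩
    c + a * g x + (x + a) * g x ≡⟨ cong (λ z → c + a * z + (x + a) * g x) (trans (p x) (sym (p a))) ⟩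
    c + a * g a + (x + a) * g x ≡⟨ cong (_+ (x + a) * g x) (e a) ⟨
    f a + (x + a) * g x        ∎
  poly-divide {ℓ} {f = f} (horner {g = g} c p@(horner _ _ _) e) a with poly-divide p a
  ... | g' , p' , e' = (λ x → g x + a * g' x)
      , subst (λ l → Poly l _ _) (+#-identityʳ ℓ) (poly-+ p (poly-raise (poly-scale a p')))
      , λ x → begin
        f x                                              ≡⟨ e x ⟩
        c + x * g x                                      ≡⟨ cong (λ z → c + x * z) (e' x) ⟩
        c + x * (g a + (x + a) * g' x)                   ≡⟨ solve 5 (λ c x a ga h → c :+ x :* (ga :+ (x :+ a) :* h)
                                                             := c :+ a :* ga :+ (x :+ a) :* (ga :+ (x :+ a) :* h :+ a :* h))
                                                             refl c x a (g a) (g' x) ⟩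
        c + a * g a + (x + a) * (g a + (x + a) * g' x + a * g' x)
                                                         ≡⟨ cong₂ (λ y z → y + (x + a) * (z + a * g' x)) (e a) (e' x) ⟨
        f a + (x + a) * (g x + a * g' x)                 ∎

  -- Dividing out the first root leaves the remaining ones as roots of the quotient, since x + a is
  -- nonzero at every point other than a.
  poly-roots-≤ : ∀ {ℓ d f} → ℓ ≢ 0# → Poly ℓ d f → (ρ : Fin (suc d) → Carrier) →
    (∀ {i j} → ρ i ≡ ρ j → i ≡ j) → ¬ (∀ i → f (ρ i) ≡ 0#)
  poly-roots-≤ ℓ≢0 (const p) ρ inj root = ℓ≢0 (trans (sym (p (ρ Fin.zero))) (root Fin.zero))
  poly-roots-≤ {f = f} ℓ≢0 p@(horner _ _ _) ρ inj root with poly-divide p (ρ Fin.zero)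
  ... | g , p' , e = poly-roots-≤ ℓ≢0 p' (ρ ∘ Fin.suc) (suc-injective ∘ inj)
      (λ i → x*y≡0⇒y≡0 (λ eq → zero≢suc (inj (x+y≡0⇒x≡y eq))) (begin
        (ρ (Fin.suc i) + a) * g (ρ (Fin.suc i))        ≡⟨ +-identityˡ _ ⟨
        0# + (ρ (Fin.suc i) + a) * g (ρ (Fin.suc i))   ≡⟨ cong (_+ (ρ (Fin.suc i) + a) * g (ρ (Fin.suc i))) (root Fin.zero) ⟨
        f a + (ρ (Fin.suc i) + a) * g (ρ (Fin.suc i))  ≡⟨ e _ ⟨
        f (ρ (Fin.suc i))                              ≡⟨ root (Fin.suc i) ⟩
        0#                                             ∎))
    where
    a = ρ Fin.zero
    zero≢suc : ∀ {n} {i : Fin n} → Fin.suc i ≢ Fin.zero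
    zero≢suc ()

  -- Only the last conjugate reaches degree 2^k; the earlier ones contribute 0 to that coefficient.
  poly-trace : ∀ k → Poly 1# (2 ^ k) (λ x → ∑ {suc k} (λ j → pow x (2 ^ toℕ j)))
  poly-trace k = poly-cong (λ x → ∑-snoc (λ j → pow x (2 ^ j)) k)
    (subst (λ l → Poly l (2 ^ k) (λ x → ∑ {k} (λ j → pow x (2 ^ toℕ j)) + pow x (2 ^ k))) (+-identityˡ 1#) (poly-+ (lower k) (poly-pow (2 ^ k))))
    where
    lower : ∀ k → Poly 0# (2 ^ k) (λ x → ∑ {k} (λ j → pow x (2 ^ toℕ j)))
    lower zero    = poly-raise (const {f = λ _ → 0#} (λ _ → refl))
    lower (suc k) = poly-raise-≤ (^-monoʳ-< 2 (s≤s (s≤s z≤n)) (n<1+n k)) (poly-trace k)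

  -- Nondegeneracy of the trace form, square roots, and pigeonhole arguments.

  -- With r = 0 the field would have one element, against 0 ≠ 1. Writing r as k + 1 exposes the
  -- exponent 2^k = q/2, the degree of the trace and the exponent of the square root.
  r≢0 : ∃ λ k → r ≡ suc k
  r≢0 = go r refl
    where
    unique : ∀ n → n ≡ 0 → (i j : Fin (2 ^ n)) → i ≡ j
    unique _ refl Fin.zero Fin.zero = refl
    go : ∀ n → r ≡ n → ∃ λ k → r ≡ suc k
    go zero    eq = ⊥-elim (0≢1 (index-injective (unique r eq (index 0#) (index 1#))))
    go (suc k) eq = k , eq

  -- The trace is a polynomial of degree q/2 with leading coefficient 1, so it cannot vanish at all
  -- q elements.
  τ-nontrivial : ∃ λ c → τ c ≡ true
  τ-nontrivial with r≢0
  ... | k , r≡suc = found (¬∀⟶∃¬ (2 ^ r) (λ i → tr (element i) ≡ 0#) (λ i → tr (element i) ≟ 0#) not-all)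
    where
    2^k<q : 2 ^ k < 2 ^ r
    2^k<q = subst (λ n → 2 ^ k < 2 ^ n) (sym r≡suc) (^-monoʳ-< 2 (s≤s (s≤s z≤n)) (n<1+n k))
    poly-tr : Poly 1# (2 ^ k) tr
    poly-tr = subst (λ n → Poly 1# (2 ^ k) (λ x → ∑ {n} (λ j → pow x (2 ^ toℕ j)))) (sym r≡suc) (poly-trace k)
    not-all : ¬ (∀ i → tr (element i) ≡ 0#)
    not-all all = poly-roots-≤ (0≢1 ∘ sym) poly-tr (λ i → element (Fin.inject≤ i 2^k<q))
      (λ {i} {j} eq → inject≤-injective 2^k<q 2^k<q i j (element-injective eq)) (λ i → all _)
    found : ∃ (λ i → tr (element i) ≢ 0#) → ∃ λ c → τ c ≡ true
    found (i , ≢0) with tr∈F₂ (element i)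
    ... | inj₁ ≡0 = contradiction ≡0 ≢0
    ... | inj₂ ≡1 = element i , trans (cong toBit ≡1) toBit-1

  τ-witness : ∀ {y} → y ≢ 0# → ∃ λ b → τ (b * y) ≡ true
  τ-witness {y} y≢0 with τ-nontrivial | inverse y y≢0
  ... | c , τc | y' , yy' = c * y' , trans (cong τ (begin
      c * y' * y    ≡⟨ *-assoc c y' y ⟩
      c * (y' * y)  ≡⟨ cong (c *_) (trans (*-comm y' y) yy') ⟩
      c * 1#        ≡⟨ *-identityʳ c ⟩
      c             ∎)) τc

  τ-nondegenerate : ∀ b → (∀ y → τ (b * y) ≡ false) → b ≡ 0#
  τ-nondegenerate b vanish with b ≟ 0#
  ... | yes b≡0 = b≡0
  ... | no b≢0 with τ-witness b≢0
  ...   | e , τe = contradiction (trans (sym τe) (trans (cong τ (*-comm e b)) (vanish e))) (λ ())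

  -- The root is y^(q/2), whose square is y^q = y.
  square-root : ∀ y → ∃ λ x → x * x ≡ y
  square-root y with r≢0
  ... | k , r≡suc = pow y (2 ^ k) , trans (sym (pow-2^suc y k)) (trans (cong (λ n → pow y (2 ^ n)) (sym r≡suc)) (x^q≡x y))

  avoid : ∀ {k} (xs : Fin k → Carrier) → k < 2 ^ r → ∃ λ y → ∀ i → y ≢ xs i
  avoid xs k<q with ¬∀⟶∃¬ (2 ^ r) (λ i → ∃ λ j → element i ≡ xs j) (λ i → any? (λ j → element i ≟ xs j)) covered
    where
    covered : ¬ (∀ i → ∃ λ j → element i ≡ xs j)
    covered f = <⇒≱ k<q (injective⇒≤ {f = λ i → proj₁ (f i)}
      (λ {i} {j} eq → element-injective (trans (proj₂ (f i)) (trans (cong xs eq) (sym (proj₂ (f j)))))))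
  ... | i , new = element i , λ j eq → new (j , eq)

  -- An injection of F into its nonzero elements, with one further point sent to 0, would embed q +
  -- 1 points into q.
  injective⇒hits-0 : (g : Carrier → Carrier) → (∀ {x y} → g x ≡ g y → x ≡ y) → ¬ (∀ x → g x ≢ 0#)
  injective⇒hits-0 g g-injective g≢0 = <⇒≱ (n<1+n (2 ^ r)) (injective⇒≤ {f = extended} extended-injective)
    where
    extended : Fin (suc (2 ^ r)) → Fin (2 ^ r)
    extended Fin.zero    = index 0#
    extended (Fin.suc i) = index (g (element i))
    extended-injective : ∀ {i j} → extended i ≡ extended j → i ≡ j
    extended-injective {Fin.zero}  {Fin.zero}  eq = refl
    extended-injective {Fin.zero}  {Fin.suc j} eq = contradiction (sym (index-injective eq)) (g≢0 _)
    extended-injective {Fin.suc i} {Fin.zero}  eq = contradiction (index-injective eq) (g≢0 _)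
    extended-injective {Fin.suc i} {Fin.suc j} eq = cong Fin.suc (element-injective (g-injective (index-injective eq)))

  -- Sets of traces that no nonzero functional kills.

  -- Every F₂-linear functional on F has the form tr (b _), so this says that `T` spans F over F₂.
  Separating : (Carrier → Set) → Set
  Separating T = ∀ b → (∀ {t} → T t → τ (b * t) ≡ false) → b ≡ 0#

  separating-⊆ : ∀ {S T : Carrier → Set} → Separating S → (∀ {t} → S t → T t) → Separating T
  separating-⊆ S-separating S⊆T b vanish = S-separating b (λ Ss → vanish (S⊆T Ss))

  -- The matrix of SO⁻(2,q) with parameters `d₁`, `d₂` has diagonal `d₁`, `d₁ + d₂`, hence trace
  -- `d₂`.
  NormOneTrace : Carrier → Set
  NormOneTrace d₂ = ∃ λ d₁ → d₁ * d₁ + d₁ * d₂ + κ * d₂ * d₂ ≡ 1#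

  -- The nonzero such traces are the 1 / N z with N z = z² + z + κ, and N is two-to-one.
  -- If all of them lay in the hyperplane τ (b _) = 0, then translating 1 / N z off the
  -- hyperplane for one z in each fibre {z, z + 1} would inject F into F \ {0}.
  normOneTraces-separating : IrreducibleZ2+Z+κ → Separating NormOneTrace
  normOneTraces-separating irreducible b vanish with b ≟ 0#
  ... | yes b≡0 = b≡0
  ... | no b≢0 = ⊥-elim (injective⇒hits-0 g g-injective g≢0)
    where
    N : Carrier → Carrier
    N z = z * z + z + κ
    N≢0 : ∀ z → N z ≢ 0#
    -- A zero z of `N` would factor the quadratic with roots z and z + 1.
    N≢0 z eq = irreducible (z , z + 1#
      , solve 1 (λ z → z :+ (z :+ con true) := con true) refl z
      , trans (solve 1 (λ z → z :* (z :+ con true) := z :* z :+ z) refl z) (x+y≡0⇒x≡y eq))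
    M : Carrier → Carrier
    M z = proj₁ (inverse (N z) (N≢0 z))
    NM : ∀ z → N z * M z ≡ 1#
    NM z = proj₂ (inverse (N z) (N≢0 z))
    M-vanish : ∀ z → τ (b * M z) ≡ false
    -- For d₂ ≠ 0 the norm form is d₂² N(d₁/d₂). With d₂ = 1/N z the ratio w = d₁/d₂ must satisfy N
    -- w = (N z)², and w = z + N z does, because N(z + u) = N z + u² + u.
    M-vanish z = vanish ((z + N z) * M z , (begin
      d₁ * d₁ + d₁ * M z + κ * M z * M z
        ≡⟨ solve 3 (λ z m k → let n = z :* z :+ z :+ k ; d = (z :+ n) :* m in
             d :* d :+ d :* m :+ k :* m :* m := n :* m :* (n :* m)) refl z (M z) κ ⟩
      N z * M z * (N z * M z)  ≡⟨ cong₂ _*_ (NM z) (NM z) ⟩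
      1# * 1#                  ≡⟨ *-identityˡ 1# ⟩
      1#                       ∎))
      where d₁ = (z + N z) * M z
    c = proj₁ τ-nontrivial
    e = proj₁ (τ-witness b≢0)
    select : Bool → Carrier
    select β = if β then e else 0#
    τ-select : ∀ β → τ (b * select β) ≡ β
    τ-select true  = trans (cong τ (*-comm b e)) (proj₂ (τ-witness b≢0))
    τ-select false = trans (cong τ (zeroʳ b)) τ-0
    -- Since τ (b * e) is true and `b` kills every `M z`, the bit τ (c * z) can be read off from
    -- `g z`. As τ c is true, this bit differs at z and z + 1, the two points that `M` does not
    -- distinguish.
    g : Carrier → Carrier
    g z = M z + select (τ (c * z))
    τ-g : ∀ z → τ (b * g z) ≡ τ (c * z)
    τ-g z = trans (cong τ (distribˡ b _ _)) (trans (τ-+ _ _) (cong₂ _xor_ (M-vanish z) (τ-select (τ (c * z)))))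
    M-injective : ∀ {z w} → M z ≡ M w → (z + w) * (z + w + 1#) ≡ 0#
    M-injective {z} {w} eq = begin
      (z + w) * (z + w + 1#)
        ≡⟨ solve 3 (λ z w k → (z :+ w) :* (z :+ w :+ con true) := (z :* z :+ z :+ k) :+ (w :* w :+ w :+ k)) refl z w κ ⟩
      N z + N w                            ≡⟨ cong₂ _+_ (*-identityʳ _) (*-identityʳ _) ⟨
      N z * 1# + N w * 1#                  ≡⟨ cong₂ (λ p q → N z * p + N w * q) (NM w) (NM z) ⟨
      N z * (N w * M w) + N w * (N z * M z) ≡⟨ cong (λ m → N z * (N w * M w) + N w * (N z * m)) eq ⟩
      N z * (N w * M w) + N w * (N z * M w)
        ≡⟨ solve 3 (λ a b m → a :* (b :* m) :+ b :* (a :* m) := con false) refl (N z) (N w) (M w) ⟩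
      0#                                   ∎
    g-injective : ∀ {z w} → g z ≡ g w → z ≡ w
    g-injective {z} {w} eq with (z + w) ≟ 0#
    ... | yes z+w≡0 = x+y≡0⇒x≡y z+w≡0
    ... | no z+w≢0 = contradiction (begin
        true                        ≡⟨ proj₂ τ-nontrivial ⟨
        τ c                         ≡⟨ cong τ (*-identityʳ c) ⟨
        τ (c * 1#)                  ≡⟨ cong (λ x → τ (c * x)) (x+y≡0⇒x≡y (x*y≡0⇒y≡0 z+w≢0 (M-injective Mz≡Mw))) ⟨
        τ (c * (z + w))             ≡⟨ trans (cong τ (distribˡ c z w)) (τ-+ _ _) ⟩
        τ (c * z) xor τ (c * w)     ≡⟨ cong (_xor τ (c * w)) same ⟩
        τ (c * w) xor τ (c * w)     ≡⟨ xor-same (τ (c * w)) ⟩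
        false                       ∎) (λ ())
      where
      same : τ (c * z) ≡ τ (c * w)
      same = trans (sym (τ-g z)) (trans (cong (λ x → τ (b * x)) eq) (τ-g w))
      Mz≡Mw : M z ≡ M w
      Mz≡Mw = begin
        M z                                              ≡⟨ solve 2 (λ m s → m := m :+ s :+ s) refl (M z) (select (τ (c * z))) ⟩
        g z + select (τ (c * z))                         ≡⟨ cong₂ (λ x β → x + select β) eq same ⟩
        g w + select (τ (c * w))                         ≡⟨ solve 2 (λ m s → m :+ s :+ s := m) refl (M w) (select (τ (c * w))) ⟩
        M w                                              ∎
    g≢0 : ∀ z → g z ≢ 0#
    g≢0 z eq = 0≢1 (begin
      0#          ≡⟨ zeroʳ (N z) ⟨
      N z * 0#    ≡⟨ cong (N z *_) Mz≡0 ⟨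
      N z * M z   ≡⟨ NM z ⟩
      1#          ∎)
      where
      τcz : τ (c * z) ≡ false
      τcz = trans (sym (τ-g z)) (trans (cong (λ x → τ (b * x)) eq) (τ-select false))
      Mz≡0 : M z ≡ 0#
      Mz≡0 = trans (sym (+#-identityʳ _)) (trans (cong (λ β → M z + select β) (sym τcz)) eq)

  PlusInverse : Carrier → Set
  PlusInverse t = ∃ λ a → ∃ λ a' → a * a' ≡ 1# × t ≡ a + a'

  -- An additive f invariant under inversion satisfies f (x² y) = f x + f y for y ≠ 0, 1/x,
  -- by Hua's identity x + x² y = (1/x + 1/(1/y + x))⁻¹. For q ≥ 8 there are y₁, y₂ such that
  -- y₁, y₂ and y₁ + y₂ all avoid 0 and 1/x, and additivity then forces f x = 0.
  plusInverse-separating : 8 ≤ 2 ^ r → Separating PlusInverse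
  plusInverse-separating 8≤q b vanish = τ-nondegenerate b f≡0
    where
    f : Carrier → Bool
    f x = τ (b * x)
    f-+ : ∀ x y → f (x + y) ≡ f x xor f y
    f-+ x y = trans (cong τ (distribˡ b x y)) (τ-+ _ _)
    xor-≡ : ∀ p q → p xor q ≡ false → p ≡ q
    xor-≡ true  true  _ = refl
    xor-≡ false false _ = refl
    f-inverse : ∀ {a a'} → a * a' ≡ 1# → f a ≡ f a'
    f-inverse {a} {a'} eq = xor-≡ _ _ (trans (sym (f-+ a a')) (vanish (a , a' , eq , refl)))

    hua : ∀ {x x'} → x * x' ≡ 1# → ∀ y → y ≢ 0# → y ≢ x' → f (x * x * y) ≡ f x xor f y
    hua {x} {x'} xx' y y≢0 y≢x' with inverse y y≢0 | inverse (1# + x * y) w≢0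
      where
      w≢0 : 1# + x * y ≢ 0#
      w≢0 eq = y≢x' (*-cancelˡ-≢0 (x*y≡1⇒x≢0 xx') (trans (sym (x+y≡0⇒x≡y eq)) (sym xx')))
    -- Here `y * w'` is 1/(1/y + x), and `x' + y * w'` is the inverse of x (1 + x y) = x + x² y.
    -- Invariance under inversion is applied to both and to `x` and `y`.
    ... | y' , yy' | w' , ww' = shuffle (f x) (f y) _ (begin
        f x xor f (x * x * y)            ≡⟨ f-+ x (x * x * y) ⟨
        f (x + x * x * y)                ≡⟨ cong f (solve 2 (λ x y → x :+ x :* x :* y := x :* (con true :+ x :* y)) refl x y) ⟩
        f (x * (1# + x * y))             ≡⟨ f-inverse inverse₂ ⟩
        f (x' + y * w')                  ≡⟨ f-+ x' (y * w') ⟩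
        f x' xor f (y * w')              ≡⟨ cong₂ _xor_ (sym (f-inverse xx')) (sym (f-inverse inverse₁)) ⟩
        f x xor f (y' + x)               ≡⟨ cong (f x xor_) (trans (f-+ y' x) (cong (_xor f x) (sym (f-inverse yy')))) ⟩
        f x xor (f y xor f x)            ∎)
      where
      inverse₁ : (y' + x) * (y * w') ≡ 1#
      inverse₁ = begin
        (y' + x) * (y * w')     ≡⟨ solve 4 (λ y y' x w → (y' :+ x) :* (y :* w) := (y :* y' :+ x :* y) :* w) refl y y' x w' ⟩
        (y * y' + x * y) * w'   ≡⟨ cong (λ z → (z + x * y) * w') yy' ⟩
        (1# + x * y) * w'       ≡⟨ ww' ⟩
        1#                      ∎
      inverse₂ : x * (1# + x * y) * (x' + y * w') ≡ 1#
      inverse₂ = begin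
        x * (1# + x * y) * (x' + y * w')
          ≡⟨ solve 4 (λ x x' y w → x :* (con true :+ x :* y) :* (x' :+ y :* w)
               := x :* x' :* (con true :+ x :* y) :+ x :* y :* ((con true :+ x :* y) :* w)) refl x x' y w' ⟩
        x * x' * (1# + x * y) + x * y * ((1# + x * y) * w')
          ≡⟨ cong₂ (λ p q → p * (1# + x * y) + x * y * q) xx' ww' ⟩
        1# * (1# + x * y) + x * y * 1#
          ≡⟨ solve 2 (λ x y → con true :* (con true :+ x :* y) :+ x :* y :* con true := con true) refl x y ⟩
        1# ∎
      shuffle : ∀ p q s → p xor s ≡ p xor (q xor p) → s ≡ p xor q
      shuffle true  true  true  ()
      shuffle true  true  false _ = refl
      shuffle true  false true  _ = refl
      shuffle true  false false ()
      shuffle false true  true  _ = refl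
      shuffle false true  false ()
      shuffle false false true  ()
      shuffle false false false _ = refl

    f≡0 : ∀ x → f x ≡ false
    f≡0 x with x ≟ 0#
    ... | yes refl = trans (cong τ (zeroʳ b)) τ-0
    ... | no x≢0 with inverse x x≢0
    ...   | x' , xx' = additive (f x) (f y₁) (f y₂) (begin
        f x xor (f y₁ xor f y₂)                          ≡⟨ cong (f x xor_) (f-+ y₁ y₂) ⟨
        f x xor f (y₁ + y₂)                              ≡⟨ hua xx' (y₁ + y₂) y₃≢0 y₃≢x' ⟨
        f (x * x * (y₁ + y₂))                            ≡⟨ cong f (distribˡ (x * x) y₁ y₂) ⟩
        f (x * x * y₁ + x * x * y₂)                      ≡⟨ f-+ _ _ ⟩
        f (x * x * y₁) xor f (x * x * y₂)                ≡⟨ cong₂ _xor_ (hua xx' y₁ (y₁∉ Fin.zero) (y₁∉ (Fin.suc Fin.zero)))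
                                                                        (hua xx' y₂ (y₂∉ Fin.zero) (y₂∉ (Fin.suc Fin.zero))) ⟩
        (f x xor f y₁) xor (f x xor f y₂)                ∎)
      where
      choice₁ = avoid (lookup (0# ∷ x' ∷ [])) (≤-trans (s≤s (s≤s (s≤s z≤n))) 8≤q)
      y₁ = proj₁ choice₁
      y₁∉ = proj₂ choice₁
      -- Excluding y₁ keeps y₁ + y₂ away from 0, and excluding x' + y₁ keeps it away from x'. Four
      -- excluded values need q > 4, that is q ≥ 8 for a power of two.
      choice₂ = avoid (lookup (0# ∷ x' ∷ y₁ ∷ x' + y₁ ∷ [])) (≤-trans (s≤s (s≤s (s≤s (s≤s (s≤s z≤n))))) 8≤q)
      y₂ = proj₁ choice₂
      y₂∉ = proj₂ choice₂
      y₃≢0 : y₁ + y₂ ≢ 0#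
      y₃≢0 eq = y₂∉ (Fin.suc (Fin.suc Fin.zero)) (sym (x+y≡0⇒x≡y eq))
      y₃≢x' : y₁ + y₂ ≢ x'
      y₃≢x' eq = y₂∉ (Fin.suc (Fin.suc (Fin.suc Fin.zero)))
        (trans (solve 2 (λ p q → q := p :+ q :+ p) refl y₁ y₂) (cong (_+ y₁) eq))
      -- The value `p` = f x occurs once on the left and twice on the right, where it cancels.
      additive : ∀ p q s → p xor (q xor s) ≡ (p xor q) xor (p xor s) → p ≡ false
      additive false _     _     _ = refl
      additive true  true  true  ()
      additive true  true  false ()
      additive true  false true  ()
      additive true  false false ()

  -- Linear algebra over F₂ and the dual code.

  -- Mirrors the sum in `InC`, so that membership in the code unfolds to `combination u t ≡ 0#` for
  -- the list `t` of traces.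
  combination : ∀ {N} → Vec Bool N → (Fin N → Carrier) → Carrier
  combination u t = ∑ (λ k → if lookup u k then t k else 0#)

  combination-+ : ∀ {N} (u w : Vec Bool N) t →
    combination (zipWith _xor_ u w) t ≡ combination u t + combination w t
  combination-+ []      []      t = sym (+-identityˡ 0#)
  combination-+ (p ∷ u) (q ∷ w) t = trans (cong₂ _+_ (head p q) (combination-+ u w (t ∘ Fin.suc)))
    (solve 4 (λ a b c d → (a :+ b) :+ (c :+ d) := (a :+ c) :+ (b :+ d)) refl _ _ _ _)
    where
    t₀ = t Fin.zero
    head : ∀ p q → (if p xor q then t₀ else 0#) ≡ (if p then t₀ else 0#) + (if q then t₀ else 0#)
    head true  true  = sym (x+x≡0 _)
    head true  false = sym (+#-identityʳ _)
    head false q     = sym (+-identityˡ _)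

  -- Adjointness: with respect to the trace form and the dot product, a ↦ c(a) is the transpose of u
  -- ↦ `combination u t`.
  τ-combination : ∀ {N} a (u : Vec Bool N) t → τ (a * combination u t) ≡ dot u (tabulate (λ k → τ (a * t k)))
  τ-combination a []      t = trans (cong τ (zeroʳ a)) τ-0
  τ-combination a (p ∷ u) t = trans (cong τ (distribˡ a _ _)) (trans (τ-+ _ _)
    (cong₂ _xor_ (head p) (τ-combination a u (t ∘ Fin.suc))))
    where
    head : ∀ p → τ (a * (if p then t Fin.zero else 0#)) ≡ p ∧ τ (a * t Fin.zero)
    head true  = refl
    head false = trans (cong τ (zeroʳ a)) τ-0

  τ-distrib : ∀ a b t → τ ((a + b) * t) ≡ τ (a * t) xor τ (b * t)
  τ-distrib a b t = trans (cong τ (distribʳ t a b)) (τ-+ _ _)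

  -- Induction on the list. If `b` separates `y` from the tail but does not kill the head t₀, the
  -- tail is tested against t₀ + y: a combination equal to it gives y after adding t₀, and otherwise
  -- a second functional is available to correct `b`.
  span⊎separate : ∀ {N} (t : Fin N → Carrier) y →
    (∃ λ u → combination u t ≡ y) ⊎ (∃ λ b → (∀ k → τ (b * t k) ≡ false) × τ (b * y) ≡ true)
  span⊎separate {zero} t y with y ≟ 0#
  ... | yes refl = inj₁ ([] , refl)
  ... | no y≢0 with τ-witness y≢0
  ...   | b , τby = inj₂ (b , (λ ()) , τby)
  span⊎separate {suc N} t y with span⊎separate (t ∘ Fin.suc) y
  ... | inj₁ (u , eq) = inj₁ (false ∷ u , trans (+-identityˡ _) eq)
  ... | inj₂ (b , ⊥t , by) with τ (b * t Fin.zero) in bt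
  ...   | false = inj₂ (b , (λ { Fin.zero → bt ; (Fin.suc k) → ⊥t k }) , by)
  ...   | true with span⊎separate (t ∘ Fin.suc) (t Fin.zero + y)
  ...     | inj₁ (u , eq) = inj₁ (true ∷ u , trans (cong (t Fin.zero +_) eq)
              (solve 2 (λ t y → t :+ (t :+ y) := y) refl (t Fin.zero) y))
  ...     | inj₂ (b' , ⊥t' , b't+y) with τ (b' * t Fin.zero) in b't | τ (b' * y) in b'y
                | trans (sym (trans (cong τ (distribˡ b' (t Fin.zero) y)) (τ-+ _ _))) b't+y
  ...       | false | q     | refl = inj₂ (b' , (λ { Fin.zero → b't ; (Fin.suc k) → ⊥t' k }) , b'y)
  -- Both functionals are 1 on t₀, while only `b` is 1 on y; their sum kills t₀ and keeps the value
  -- 1 on y.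
  ...       | true  | false | refl = inj₂ (b + b'
              , (λ { Fin.zero → trans (τ-distrib b b' _) (cong₂ _xor_ bt b't)
                   ; (Fin.suc k) → trans (τ-distrib b b' _) (cong₂ _xor_ (⊥t k) (⊥t' k)) })
              , trans (τ-distrib b b' y) (cong₂ _xor_ by b'y))

  -- Given a solution `a` for the tail that misses the head bit, there are two cases. If t₀ lies in
  -- the span of the tail, the resulting relation detects the wrong bit. Otherwise a functional
  -- killing the tail but not t₀ is added to `a` and flips only that bit.
  fredholm : ∀ {N} (t : Fin N → Carrier) (v : Vec Bool N) →
    (∃ λ a → tabulate (λ k → τ (a * t k)) ≡ v) ⊎ (∃ λ u → combination u t ≡ 0# × dot u v ≡ true)
  fredholm t [] = inj₁ (0# , refl)
  fredholm t (β ∷ v) with fredholm (t ∘ Fin.suc) v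
  ... | inj₂ (u , eq , uv) = inj₂ (false ∷ u , trans (+-identityˡ _) eq , uv)
  ... | inj₁ (a , refl) with β Data.Bool.≟ τ (a * t Fin.zero)
  ...   | yes refl = inj₁ (a , refl)
  ...   | no β≢ with span⊎separate (t ∘ Fin.suc) (t Fin.zero)
  ...     | inj₁ (u , eq) = inj₂ (true ∷ u , trans (cong (t Fin.zero +_) eq) (x+x≡0 _)
              , trans (cong (β xor_) (trans (sym (τ-combination a u (t ∘ Fin.suc))) (cong (λ z → τ (a * z)) eq)))
                (≢⇒xor β _ β≢))
    where
    ≢⇒xor : ∀ p q → p ≢ q → p xor q ≡ true
    ≢⇒xor true  true  ≢ = contradiction refl ≢
    ≢⇒xor true  false ≢ = refl
    ≢⇒xor false true  ≢ = refl
    ≢⇒xor false false ≢ = contradiction refl ≢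
  ...     | inj₂ (b , ⊥t , bt) = inj₁ (a + b , cong₂ _∷_
              (trans (τ-distrib a b _) (trans (cong (τ (a * t Fin.zero) xor_) bt) (flip _ _ β≢)))
              (tabulate-cong (λ k → trans (τ-distrib a b _) (trans (cong (τ (a * t (Fin.suc k)) xor_) (⊥t k)) (xor-identityʳ _)))))
    where
    flip : ∀ p q → q ≢ p → p xor true ≡ q
    flip true  true  ≢ = contradiction refl ≢
    flip true  false ≢ = refl
    flip false true  ≢ = refl
    flip false false ≢ = contradiction refl ≢

  Attained : ∀ {d N} → (Fin N → Mat d d) → Carrier → Set
  Attained gs t = ∃ λ k → Tr (gs k) ≡ t

  code-isomorphism : ∀ {d N} (gs : Fin N → Mat d d) →
    Separating (Attained gs) → IsLinearIsoOntoC⊥ gs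
  code-isomorphism gs separating = in-dual , additive , injective , surjective
    where
    t = λ k → Tr (gs k)
    in-dual : ∀ a → InC⊥ gs (cw gs a)
    in-dual a u u∈C = trans (sym (τ-combination a u t)) (trans (cong (λ z → τ (a * z)) u∈C) (trans (cong τ (zeroʳ a)) τ-0))
    additive : ∀ a b → cw gs (a + b) ≡ zipWith _xor_ (cw gs a) (cw gs b)
    additive a b = trans (tabulate-cong (λ k → τ-distrib a b (t k))) (zipWith-tabulate _ _)
      where
      zipWith-tabulate : ∀ {n} (f g : Fin n → Bool) →
        tabulate (λ k → f k xor g k) ≡ zipWith _xor_ (tabulate f) (tabulate g)
      zipWith-tabulate {zero}  f g = refl
      zipWith-tabulate {suc n} f g = cong ((f Fin.zero xor g Fin.zero) ∷_) (zipWith-tabulate (f ∘ Fin.suc) (g ∘ Fin.suc))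
    injective : ∀ a b → cw gs a ≡ cw gs b → a ≡ b
    injective a b eq = x+y≡0⇒x≡y (separating (a + b) λ { (k , refl) → begin
      τ ((a + b) * t k)              ≡⟨ τ-distrib a b (t k) ⟩
      τ (a * t k) xor τ (b * t k)    ≡⟨ cong (_xor τ (b * t k)) (tabulate-injective eq k) ⟩
      τ (b * t k) xor τ (b * t k)    ≡⟨ xor-same (τ (b * t k)) ⟩
      false                          ∎ })
      where
      tabulate-injective : ∀ {n} {f g : Fin n → Bool} → tabulate f ≡ tabulate g → ∀ k → f k ≡ g k
      tabulate-injective {f = f} {g} eq k =
        trans (sym (lookup∘tabulate f k)) (trans (cong (λ v → lookup v k) eq) (lookup∘tabulate g k))
    surjective : ∀ v → InC⊥ gs v → ∃ λ a → cw gs a ≡ v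
    surjective v v∈C⊥ with fredholm t v
    ... | inj₁ solution         = solution
    ... | inj₂ (u , u∈C , uv≡1) = contradiction (trans (sym uv≡1) (v∈C⊥ u u∈C)) (λ ())

  squares-separating : Separating (λ t → ∃ λ x → x * x ≡ t)
  squares-separating b vanish = τ-nondegenerate b (λ y → vanish (square-root y))

  -- Block matrix products and the trace of X σ_s q.

  ∑-δˡ : ∀ {n} (f : Fin n → Carrier) a → ∑ (λ j → δᵢⱼ a j * f j) ≡ f a
  ∑-δˡ f Fin.zero = trans (cong₂ _+_ (*-identityˡ _) (∑-zero _ (λ j → zeroˡ (f (Fin.suc j))))) (+#-identityʳ _)
  ∑-δˡ f (Fin.suc a) = trans (cong₂ _+_ (zeroˡ _) (∑-δˡ (f ∘ Fin.suc) a)) (+-identityˡ _)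

  ∑-δʳ : ∀ {n} (f : Fin n → Carrier) b → ∑ (λ j → f j * δᵢⱼ j b) ≡ f b
  ∑-δʳ f Fin.zero = trans (cong₂ _+_ (*-identityʳ _) (∑-zero _ (λ j → zeroʳ (f (Fin.suc j))))) (+#-identityʳ _)
  ∑-δʳ f (Fin.suc b) = trans (cong₂ _+_ (zeroʳ _) (∑-δʳ (f ∘ Fin.suc) b)) (+-identityˡ _)

  ∑-++ : ∀ m {n} (f : Fin (m ℕ.+ n) → Carrier) → ∑ f ≡ ∑ (λ i → f (i ↑ˡ n)) + ∑ (λ j → f (m ↑ʳ j))
  ∑-++ zero    f = sym (+-identityˡ _)
  ∑-++ (suc m) f = trans (cong (f Fin.zero +_) (∑-++ m (f ∘ Fin.suc))) (sym (+-assoc _ _ _))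

  at : ∀ {m} → Part m → Fin (dim m)
  at {m} (first a)  = (a ↑ˡ m) ↑ˡ 2
  at {m} (second b) = (m ↑ʳ b) ↑ˡ 2
  at {m} (third c)  = (m ℕ.+ m) ↑ʳ c

  part-at : ∀ {m} (p : Part m) → part m (at p) ≡ p
  part-at {m} (first a)  rewrite splitAt-↑ˡ (m ℕ.+ m) (a ↑ˡ m) 2 | splitAt-↑ˡ m a m = refl
  part-at {m} (second b) rewrite splitAt-↑ˡ (m ℕ.+ m) (m ↑ʳ b) 2 | splitAt-↑ʳ m m b = refl
  part-at {m} (third c)  rewrite splitAt-↑ʳ (m ℕ.+ m) 2 c = refl

  ∑ₚ : ∀ {m} → (Part m → Carrier) → Carrier
  ∑ₚ f = ∑ (f ∘ first) + ∑ (f ∘ second) + ∑ (f ∘ third)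

  ∑-at : ∀ {m} (f : Fin (dim m) → Carrier) (g : Part m → Carrier) → (∀ p → f (at p) ≡ g p) → ∑ f ≡ ∑ₚ g
  ∑-at {m} f g eq = begin
    ∑ f                                        ≡⟨ ∑-++ (m ℕ.+ m) f ⟩
    ∑ (λ i → f (i ↑ˡ 2)) + ∑ (f′ ∘ third)      ≡⟨ cong (_+ ∑ (f′ ∘ third)) (∑-++ m (λ i → f (i ↑ˡ 2))) ⟩
    ∑ₚ f′                                      ≡⟨ cong₂ _+_ (cong₂ _+_ (∑-cong (eq ∘ first)) (∑-cong (eq ∘ second)))
                                                    (∑-cong {f = f′ ∘ third} {g = g ∘ third} (eq ∘ third)) ⟩
    ∑ₚ g                                       ∎
    where
    f′ : Part m → Carrier
    f′ p = f (at p)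

  module _ {m : ℕ} (f : Part m → Carrier) where
    ∑ₚ-first : ∀ {w} → ∑ (f ∘ first) ≡ w → (∀ b → f (second b) ≡ 0#) → (∀ c → f (third c) ≡ 0#) → ∑ₚ f ≡ w
    ∑ₚ-first eq z₂ z₃ = trans (cong₂ _+_ (cong₂ _+_ eq (∑-zero (f ∘ second) z₂)) (∑-zero (f ∘ third) z₃))
      (trans (+#-identityʳ _) (+#-identityʳ _))

    ∑ₚ-second : ∀ {w} → (∀ a → f (first a) ≡ 0#) → ∑ (f ∘ second) ≡ w → (∀ c → f (third c) ≡ 0#) → ∑ₚ f ≡ w
    ∑ₚ-second z₁ eq z₃ = trans (cong₂ _+_ (cong₂ _+_ (∑-zero (f ∘ first) z₁) eq) (∑-zero (f ∘ third) z₃))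
      (trans (+#-identityʳ _) (+-identityˡ _))

    ∑ₚ-third : ∀ {w} → (∀ a → f (first a) ≡ 0#) → (∀ b → f (second b) ≡ 0#) → ∑ (f ∘ third) ≡ w → ∑ₚ f ≡ w
    ∑ₚ-third {w} z₁ z₂ eq = trans (cong₂ _+_ (cong₂ _+_ (∑-zero (f ∘ first) z₁) (∑-zero (f ∘ second) z₂)) eq)
      (trans (cong (_+ w) (+-identityˡ 0#)) (+-identityˡ w))

    ∑ₚ-zero : (∀ a → f (first a) ≡ 0#) → (∀ b → f (second b) ≡ 0#) → (∀ c → f (third c) ≡ 0#) → ∑ₚ f ≡ 0#
    ∑ₚ-zero z₁ z₂ z₃ = ∑ₚ-first (∑-zero (f ∘ first) z₁) z₂ z₃

  -- Indexing by `Part m` makes the blocks visible to pattern matching, without the `splitAt` hidden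
  -- in `blocks` and `σ`.
  BlockTable : ℕ → Set
  BlockTable m = Part m → Part m → Carrier

  table : ∀ {m} →
    Mat m m → Mat m m → Mat m 2 →
    Mat m m → Mat m m → Mat m 2 →
    Mat 2 m → Mat 2 m → Mat 2 2 → BlockTable m
  table X₁₁ X₁₂ X₁₃ X₂₁ X₂₂ X₂₃ X₃₁ X₃₂ X₃₃ = λ where
    (first a)  (first b)  → X₁₁ a b
    (first a)  (second b) → X₁₂ a b
    (first a)  (third b)  → X₁₃ a b
    (second a) (first b)  → X₂₁ a b
    (second a) (second b) → X₂₂ a b
    (second a) (third b)  → X₂₃ a b
    (third a)  (first b)  → X₃₁ a b
    (third a)  (second b) → X₃₂ a b
    (third a)  (third b)  → X₃₃ a b

  infix 4 _≈ₚ_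
  _≈ₚ_ : ∀ {m} → Mat (dim m) (dim m) → BlockTable m → Set
  M ≈ₚ P = ∀ p p' → M (at p) (at p') ≡ P p p'

  blocks-at : ∀ {m} X₁₁ X₁₂ X₁₃ X₂₁ X₂₂ X₂₃ X₃₁ X₃₂ X₃₃ →
    blocks m X₁₁ X₁₂ X₁₃ X₂₁ X₂₂ X₂₃ X₃₁ X₃₂ X₃₃ ≈ₚ table X₁₁ X₁₂ X₁₃ X₂₁ X₂₂ X₂₃ X₃₁ X₃₂ X₃₃
  blocks-at _ _ _ _ _ _ _ _ _ p p' rewrite part-at p | part-at p' with p | p'
  ... | first _  | first _  = refl
  ... | first _  | second _ = refl
  ... | first _  | third _  = refl
  ... | second _ | first _  = refl
  ... | second _ | second _ = refl
  ... | second _ | third _  = refl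
  ... | third _  | first _  = refl
  ... | third _  | second _ = refl
  ... | third _  | third _  = refl

  term : ∀ {m} → BlockTable m → BlockTable m → Part m → Part m → Part m → Carrier
  term P R p p' s = P p s * R s p'

  ⊗-at : ∀ {m} (M N : Mat (dim m) (dim m)) (P R S : BlockTable m) → M ≈ₚ P → N ≈ₚ R →
    (∀ p p' → ∑ₚ (term P R p p') ≡ S p p') → M ⊗ N ≈ₚ S
  ⊗-at M N P R S M≈P N≈R entry p p' = trans
    (∑-at (λ j → M (at p) j * N j (at p')) (term P R p p') (λ s → cong₂ _*_ (M≈P p s) (N≈R s p')))
    (entry p p')

  -- The two factors of `qElem` multiplied out blockwise.
  qTable : ∀ {m} → Mat m m → Mat m m → Mat 2 2 → Mat m m → Mat 2 m → BlockTable m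
  qTable A A' i B h = table A (A ⊗ B) (A ⊗ (ᵗ h ⊗ ᵗ i ⊗ η ⊗ i)) 𝟘 (ᵗ A') 𝟘 𝟘 (i ⊗ h) i

  qElem-at : ∀ {m} A A' i B h → qElem m A A' i B h ≈ₚ qTable A A' i B h
  qElem-at {m} A A' i B h = ⊗-at
    (blocks m A 𝟘 𝟘 𝟘 (ᵗ A') 𝟘 𝟘 𝟘 i) (blocks m 𝟙 B U 𝟘 𝟙 𝟘 𝟘 h 𝟙) P R (qTable A A' i B h)
    (blocks-at A 𝟘 𝟘 𝟘 (ᵗ A') 𝟘 𝟘 𝟘 i) (blocks-at 𝟙 B U 𝟘 𝟙 𝟘 𝟘 h 𝟙) entry
    where
    U : Mat m 2
    U = ᵗ h ⊗ ᵗ i ⊗ η ⊗ i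
    P R : BlockTable m
    P = table A 𝟘 𝟘 𝟘 (ᵗ A') 𝟘 𝟘 𝟘 i
    R = table 𝟙 B U 𝟘 𝟙 𝟘 𝟘 h 𝟙
    entry : ∀ p p' → ∑ₚ (term P R p p') ≡ qTable A A' i B h p p'
    entry p@(first a)  p'@(first b)  = ∑ₚ-first  (term P R p p') (∑-δʳ (A a) b) (λ _ → zeroˡ _) (λ _ → zeroˡ _)
    entry p@(first a)  p'@(second b) = ∑ₚ-first  (term P R p p') refl (λ _ → zeroˡ _) (λ _ → zeroˡ _)
    entry p@(first a)  p'@(third c)  = ∑ₚ-first  (term P R p p') refl (λ _ → zeroˡ _) (λ _ → zeroˡ _)
    entry p@(second a) p'@(first b)  = ∑ₚ-zero   (term P R p p') (λ _ → zeroˡ _) (λ _ → zeroʳ _) (λ _ → zeroˡ _)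
    entry p@(second a) p'@(second b) = ∑ₚ-second (term P R p p') (λ _ → zeroˡ _) (∑-δʳ (λ j → A' j a) b) (λ _ → zeroˡ _)
    entry p@(second a) p'@(third c)  = ∑ₚ-zero   (term P R p p') (λ _ → zeroˡ _) (λ _ → zeroʳ _) (λ _ → zeroˡ _)
    entry p@(third c)  p'@(first b)  = ∑ₚ-zero   (term P R p p') (λ _ → zeroˡ _) (λ _ → zeroˡ _) (λ _ → zeroʳ _)
    entry p@(third c)  p'@(second b) = ∑ₚ-third  (term P R p p') (λ _ → zeroˡ _) (λ _ → zeroˡ _) refl
    entry p@(third c)  p'@(third d)  = ∑ₚ-third  (term P R p p') (λ _ → zeroˡ _) (λ _ → zeroˡ _) (∑-δʳ (i c) d)

  lift : ∀ {m} → Mat 2 2 → BlockTable m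
  lift Y = table 𝟙 𝟘 𝟘 𝟘 𝟙 𝟘 𝟘 𝟘 Y

  -- Kept in the form `qElem` so that membership in Q holds by reflexivity; it is the left factor q₁
  -- in X q₁ σ_s q₂.
  identityQ : ∀ m → Mat (dim m) (dim m)
  identityQ m = qElem m 𝟙 𝟙 𝟙 𝟘 𝟘

  identityQ-at : ∀ {m} → identityQ m ≈ₚ lift 𝟙
  identityQ-at {m} p p' = trans (qElem-at 𝟙 𝟙 𝟙 𝟘 𝟘 p p') (entry p p')
    where
    V : Mat m 2
    V = ᵗ (𝟘 {2} {m}) ⊗ ᵗ 𝟙
    V≡0 : ∀ a c → V a c ≡ 0#
    V≡0 a c = ∑-zero (λ j → 0# * 𝟙 c j) (λ j → zeroˡ (𝟙 c j))
    V⊗η≡0 : ∀ a c → (V ⊗ η) a c ≡ 0#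
    V⊗η≡0 a c = ∑-zero (λ j → V a j * η j c) (λ j → trans (cong (_* η j c) (V≡0 a j)) (zeroˡ (η j c)))
    U : Mat m 2
    U = V ⊗ η ⊗ 𝟙
    U≡0 : ∀ a c → U a c ≡ 0#
    U≡0 a c = trans (∑-δʳ ((V ⊗ η) a) c) (V⊗η≡0 a c)
    transpose-𝟙 : ∀ a b → 𝟙 {m} a b ≡ 𝟙 b a
    transpose-𝟙 a b with a ≟ᶠ b | b ≟ᶠ a
    ... | yes _   | yes _   = refl
    ... | yes a≡b | no b≢a  = contradiction (sym a≡b) b≢a
    ... | no a≢b  | yes b≡a = contradiction (sym b≡a) a≢b
    ... | no _    | no _    = refl
    entry : ∀ p p' → qTable 𝟙 𝟙 𝟙 𝟘 𝟘 p p' ≡ lift 𝟙 p p'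
    entry (first a)  (first b)  = refl
    entry (first a)  (second b) = ∑-zero (λ j → 𝟙 a j * 0#) (λ j → zeroʳ (𝟙 a j))
    entry (first a)  (third c)  = trans (∑-δˡ (λ j → U j c) a) (U≡0 a c)
    entry (second a) (first b)  = refl
    entry (second a) (second b) = transpose-𝟙 b a
    entry (second a) (third c)  = refl
    entry (third c)  (first b)  = refl
    entry (third c)  (second b) = ∑-zero (λ j → 𝟙 c j * 0#) (λ j → zeroʳ (𝟙 c j))
    entry (third c)  (third d)  = refl

  lift-𝟙 : ∀ {m} → 𝟙 ⊗ identityQ m ≈ₚ lift {m} 𝟙
  lift-𝟙 {m} p p' = trans (∑-δˡ (λ k → identityQ m k (at p')) (at p)) (identityQ-at p p')

  ρ₂ : Mat 2 2
  ρ₂ = mat2 1# 1# 0# 1#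

  lift-ρ : ∀ {m} → ρ m ⊗ identityQ m ≈ₚ lift {m} ρ₂
  lift-ρ {m} = ⊗-at (ρ m) (identityQ m) P R P (blocks-at 𝟙 𝟘 𝟘 𝟘 𝟙 𝟘 𝟘 𝟘 ρ₂) identityQ-at entry
    where
    P R : BlockTable m
    P = lift ρ₂
    R = lift 𝟙
    entry : ∀ p p' → ∑ₚ (term P R p p') ≡ P p p'
    entry p@(first a)  p'@(first b)  = ∑ₚ-first  (term P R p p') (∑-δʳ (𝟙 a) b) (λ _ → zeroˡ _) (λ _ → zeroˡ _)
    entry p@(first a)  p'@(second b) = ∑ₚ-zero   (term P R p p') (λ _ → zeroʳ _) (λ _ → zeroˡ _) (λ _ → zeroˡ _)
    entry p@(first a)  p'@(third c)  = ∑ₚ-zero   (term P R p p') (λ _ → zeroʳ _) (λ _ → zeroˡ _) (λ _ → zeroˡ _)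
    entry p@(second a) p'@(first b)  = ∑ₚ-zero   (term P R p p') (λ _ → zeroˡ _) (λ _ → zeroʳ _) (λ _ → zeroˡ _)
    entry p@(second a) p'@(second b) = ∑ₚ-second (term P R p p') (λ _ → zeroˡ _) (∑-δʳ (𝟙 a) b) (λ _ → zeroˡ _)
    entry p@(second a) p'@(third c)  = ∑ₚ-zero   (term P R p p') (λ _ → zeroˡ _) (λ _ → zeroʳ _) (λ _ → zeroˡ _)
    entry p@(third c)  p'@(first b)  = ∑ₚ-zero   (term P R p p') (λ _ → zeroˡ _) (λ _ → zeroˡ _) (λ _ → zeroʳ _)
    entry p@(third c)  p'@(second b) = ∑ₚ-zero   (term P R p p') (λ _ → zeroˡ _) (λ _ → zeroˡ _) (λ _ → zeroʳ _)
    entry p@(third c)  p'@(third d)  = ∑ₚ-third  (term P R p p') (λ _ → zeroˡ _) (λ _ → zeroˡ _) (∑-δʳ (ρ₂ c) d)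

  module _ {m : ℕ} (s : ℕ) where
    kept swapped : Mat m m
    kept    a b = if does (toℕ a <? s) then 0# else δᵢⱼ a b
    swapped a b = if does (toℕ a <? s) then δᵢⱼ a b else 0#

    σTable : Mat 2 2 → BlockTable m
    σTable Y = table kept swapped 𝟘 swapped kept 𝟘 𝟘 𝟘 Y

    σ-at : σ m s ≈ₚ σTable 𝟙
    σ-at p p' rewrite part-at p | part-at p' with p | p'
    ... | first _  | first _  = refl
    ... | first _  | second _ = refl
    ... | first _  | third _  = refl
    ... | second _ | first _  = refl
    ... | second _ | second _ = refl
    ... | second _ | third _  = refl
    ... | third _  | first _  = refl
    ... | third _  | second _ = refl
    ... | third _  | third _  = refl

    lift-σ : ∀ M Y → M ≈ₚ lift Y → M ⊗ σ m s ≈ₚ σTable Y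
    lift-σ M Y M≈Y = ⊗-at M (σ m s) P R (σTable Y) M≈Y σ-at entry
      where
      P R : BlockTable m
      P = lift Y
      R = σTable 𝟙
      entry : ∀ p p' → ∑ₚ (term P R p p') ≡ σTable Y p p'
      entry p@(first a)  p'@(first b)  = ∑ₚ-first  (term P R p p') (∑-δˡ (λ j → kept j b) a) (λ _ → zeroˡ _) (λ _ → zeroˡ _)
      entry p@(first a)  p'@(second b) = ∑ₚ-first  (term P R p p') (∑-δˡ (λ j → swapped j b) a) (λ _ → zeroˡ _) (λ _ → zeroˡ _)
      entry p@(first a)  p'@(third c)  = ∑ₚ-zero   (term P R p p') (λ _ → zeroʳ _) (λ _ → zeroˡ _) (λ _ → zeroˡ _)
      entry p@(second a) p'@(first b)  = ∑ₚ-second (term P R p p') (λ _ → zeroˡ _) (∑-δˡ (λ j → swapped j b) a) (λ _ → zeroˡ _)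
      entry p@(second a) p'@(second b) = ∑ₚ-second (term P R p p') (λ _ → zeroˡ _) (∑-δˡ (λ j → kept j b) a) (λ _ → zeroˡ _)
      entry p@(second a) p'@(third c)  = ∑ₚ-zero   (term P R p p') (λ _ → zeroˡ _) (λ _ → zeroʳ _) (λ _ → zeroˡ _)
      entry p@(third c)  p'@(first b)  = ∑ₚ-zero   (term P R p p') (λ _ → zeroˡ _) (λ _ → zeroˡ _) (λ _ → zeroʳ _)
      entry p@(third c)  p'@(second b) = ∑ₚ-zero   (term P R p p') (λ _ → zeroˡ _) (λ _ → zeroˡ _) (λ _ → zeroʳ _)
      entry p@(third c)  p'@(third d)  = ∑ₚ-third  (term P R p p') (λ _ → zeroˡ _) (λ _ → zeroˡ _) (∑-δʳ (Y c) d)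

    ∑-kept : ∀ a (f : Fin m → Carrier) → ∑ (λ j → kept a j * f j) ≡ (if does (toℕ a <? s) then 0# else f a)
    ∑-kept a f with does (toℕ a <? s)
    ... | true  = ∑-zero (λ j → 0# * f j) (λ j → zeroˡ (f j))
    ... | false = ∑-δˡ f a

    ∑-swapped : ∀ a (f : Fin m → Carrier) → ∑ (λ j → swapped a j * f j) ≡ (if does (toℕ a <? s) then f a else 0#)
    ∑-swapped a f with does (toℕ a <? s)
    ... | true  = ∑-δˡ f a
    ... | false = ∑-zero (λ j → 0# * f j) (λ j → zeroˡ (f j))

    -- At a swapped index the first row becomes a second-block row of `q`, which is zero in the
    -- first columns, and the second row becomes a row of (A, A B, ...), leaving the diagonal of A
    -- B. Unswapped indices keep A and the transpose of A⁻¹.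
    diagonal : Mat 2 2 → Mat m m → Mat m m → Mat 2 2 → Mat m m → Part m → Carrier
    diagonal Y A A' i B (first a)  = if does (toℕ a <? s) then 0# else A a a
    diagonal Y A A' i B (second b) = if does (toℕ b <? s) then (A ⊗ B) b b else A' b b
    diagonal Y A A' i B (third c)  = (Y ⊗ i) c c

    Tr-lift-σ-qElem : ∀ M Y → M ≈ₚ lift Y → ∀ A A' i B h →
      Tr (M ⊗ σ m s ⊗ qElem m A A' i B h) ≡ ∑ₚ (diagonal Y A A' i B)
    Tr-lift-σ-qElem M Y M≈Y A A' i B h = ∑-at (λ k → (M ⊗ σ m s ⊗ qElem m A A' i B h) k k) _
      (λ p → ⊗-at (M ⊗ σ m s) (qElem m A A' i B h) P R (λ p p' → ∑ₚ (term P R p p')) (lift-σ M Y M≈Y) (qElem-at A A' i B h) (λ _ _ → refl) p p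
             ⟨ trans ⟩ entry p)
      where
      P R : BlockTable m
      P = σTable Y
      R = qTable A A' i B h
      merge : ∀ β x y → (if β then x else 0#) + (if β then 0# else y) ≡ (if β then x else y)
      merge true  x y = +#-identityʳ x
      merge false x y = +-identityˡ y
      entry : ∀ p → ∑ₚ (term P R p p) ≡ diagonal Y A A' i B p
      entry p@(first a)  = ∑ₚ-first (term P R p p) (∑-kept a (λ j → A j a)) (λ _ → zeroʳ _) (λ _ → zeroˡ _)
      entry p@(second b) = trans
        (cong₂ _+_ (cong₂ _+_ (∑-swapped b (λ j → (A ⊗ B) j b)) (∑-kept b (A' b)))
                   (∑-zero (term P R p p ∘ third) (λ _ → zeroˡ _)))
        (trans (+#-identityʳ _) (merge (does (toℕ b <? s)) ((A ⊗ B) b b) (A' b b)))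
      entry p@(third c)  = ∑ₚ-third (term P R p p) (λ _ → zeroˡ _) (λ _ → zeroˡ _) refl

  -- Explicit elements of the double cosets and their traces.

  so₂ : Carrier → Carrier → Mat 2 2
  so₂ d₁ d₂ = mat2 d₁ (κ * d₂) d₂ (d₁ + d₂)

  norm-1-0 : 1# * 1# + 1# * 0# + κ * 0# * 0# ≡ 1#
  norm-1-0 = solve 1 (λ k → con true :* con true :+ con true :* con false :+ k :* con false :* con false := con true) refl κ

  𝟙-invertible : ∀ {n} → Invertible (𝟙 {n}) 𝟙
  𝟙-invertible = (λ i j → ∑-δˡ (λ k → 𝟙 k j) i) , (λ i j → ∑-δˡ (λ k → 𝟙 k j) i)

  identityQ∈Q : ∀ m → InQ m (identityQ m)
  identityQ∈Q m = 𝟙 , 𝟙 , 𝟙 , 𝟘 , 𝟘 , 𝟙-invertible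
    , (1# , 0# , norm-1-0 , λ where
        Fin.zero           Fin.zero           → refl
        Fin.zero           (Fin.suc Fin.zero) → sym (zeroʳ κ)
        (Fin.suc Fin.zero) Fin.zero           → refl
        (Fin.suc Fin.zero) (Fin.suc Fin.zero) → sym (+#-identityʳ 1#))
    , ((λ a b → trans (vanish a b) (sym (vanish b a))) , λ a → vanish a a)
    , λ _ _ → refl
    where
    W : Mat m 2
    W = ᵗ 𝟘 ⊗ δ
    vanish : ∀ a b → 0# + (W ⊗ 𝟘 {2} {m}) a b ≡ 0#
    vanish a b = trans (+-identityˡ _) (∑-zero (λ j → W a j * 0#) (λ j → zeroʳ (W a j)))

  attained : ∀ m X s {N} {gs : Fin N → Mat (dim m) (dim m)} → Enumerates (InXQσQ m X s) gs →
    ∀ Y → X ⊗ identityQ m ≈ₚ lift {m} Y → ∀ A A' → Invertible A A' →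
    ∀ d₁ d₂ → d₁ * d₁ + d₁ * d₂ + κ * d₂ * d₂ ≡ 1# → ∀ h {t} →
    ∑ₚ (diagonal s Y A A' (so₂ d₁ d₂) (ᵗ (ᵗ h ⊗ δ ⊗ h))) ≡ t → Attained gs t
  attained m X s {gs = gs} enumerates Y lifts A A' invertible d₁ d₂ norm h trace≡ = k , trans
      (∑-cong (λ j → sym (g≐gsₖ j j))) (trans (Tr-lift-σ-qElem s (X ⊗ identityQ m) Y lifts A A' i B h) trace≡)
    where
    i : Mat 2 2
    i = so₂ d₁ d₂
    B : Mat m m
    -- With this choice ᵗB + ᵗh δ h is twice a matrix, hence zero and alternating, so `h` may be
    -- chosen freely.
    B = ᵗ (ᵗ h ⊗ δ ⊗ h)
    q : Mat (dim m) (dim m)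
    q = qElem m A A' i B h
    q∈Q : InQ m q
    q∈Q = A , A' , i , B , h , invertible , (d₁ , d₂ , norm , λ _ _ → refl)
      , ((λ a b → trans (x+x≡0 _) (sym (x+x≡0 _))) , λ a → x+x≡0 _)
      , λ _ _ → refl
    listed : ∃ λ k → X ⊗ identityQ m ⊗ σ m s ⊗ q ≐ gs k
    listed = proj₁ enumerates _ (identityQ m , q , identityQ∈Q m , q∈Q , λ _ _ → refl)
    k = proj₁ listed
    g≐gsₖ = proj₂ listed

  Tr-𝟙-so₂ : ∀ d₁ d₂ → Tr (𝟙 ⊗ so₂ d₁ d₂) ≡ d₂
  Tr-𝟙-so₂ d₁ d₂ = solve 3 (λ k x y →
    (con true :* x :+ (con false :* y :+ con false))
    :+ ((con false :* (k :* y) :+ (con true :* (x :+ y) :+ con false)) :+ con false) := y) refl κ d₁ d₂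

  -- Elements of O⁻(2,q) outside SO⁻(2,q) have trace 0. Thus with `X = ρ` the traces must come
  -- entirely from `A` and `B`.
  Tr-ρ₂-so₂ : ∀ d₁ d₂ → Tr (ρ₂ ⊗ so₂ d₁ d₂) ≡ 0#
  Tr-ρ₂-so₂ d₁ d₂ = solve 3 (λ k x y →
    (con true :* x :+ (con true :* y :+ con false))
    :+ ((con false :* (k :* y) :+ (con true :* (x :+ y) :+ con false)) :+ con false) := con false) refl κ d₁ d₂

  -- Taking A = 1 makes the two large diagonal blocks cancel in characteristic 2, leaving the trace
  -- of the SO⁻(2,q) part. This serves n = 1 for `i1` and n = 2 for `i2`.
  traces-σ₀ : ∀ {m N} {gs : Fin N → Mat (dim m) (dim m)} → IrreducibleZ2+Z+κ →
    Enumerates (InXQσQ m 𝟙 0) gs → Separating (Attained gs)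
  traces-σ₀ {m} irreducible enumerates = separating-⊆ {NormOneTrace} (normOneTraces-separating irreducible)
    λ { {d₂} (d₁ , norm) → attained m 𝟙 0 enumerates 𝟙 (lift-𝟙 {m}) 𝟙 𝟙 𝟙-invertible d₁ d₂ norm 𝟘 (begin
      Tr 𝟙ₘ + Tr 𝟙ₘ + Tr (𝟙 ⊗ so₂ d₁ d₂)  ≡⟨ cong₂ _+_ (x+x≡0 (Tr 𝟙ₘ)) (Tr-𝟙-so₂ d₁ d₂) ⟩
      0# + d₂                             ≡⟨ +-identityˡ d₂ ⟩
      d₂                                  ∎) }
    where
    𝟙ₘ : Mat m m
    𝟙ₘ = 𝟙

  -- With A = 1, i = 1 and h the matrix whose only nonzero entry is x in the first place, the trace is x².
  traces-σ₊ : ∀ {m s N} X Y {gs : Fin N → Mat (dim (suc m)) (dim (suc m))} →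
    X ⊗ identityQ (suc m) ≈ₚ lift {suc m} Y → Tr (Y ⊗ so₂ 1# 0#) ≡ 0# →
    Enumerates (InXQσQ (suc m) X (suc s)) gs → Separating (Attained gs)
  traces-σ₊ {m} {s} X Y lifts TrY≡0 enumerates = separating-⊆ {λ t → ∃ λ x → x * x ≡ t} squares-separating
    λ { (x , refl) → attained (suc m) X (suc s) enumerates Y lifts 𝟙 𝟙 𝟙-invertible 1# 0# norm-1-0 (h x) (trace≡ x) }
    where
    h : Carrier → Mat 2 (suc m)
    h x Fin.zero    Fin.zero    = x
    h x Fin.zero    (Fin.suc _) = 0#
    h x (Fin.suc _) _           = 0#
    B : Carrier → Mat (suc m) (suc m)
    B x = ᵗ (ᵗ (h x) ⊗ δ ⊗ h x)
    B-zero : ∀ x → B x Fin.zero Fin.zero ≡ x * x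
    B-zero x = solve 2 (λ k x →
      (x :* con true :+ (con false :* con false :+ con false)) :* x
      :+ ((x :* con true :+ (con false :* k :+ con false)) :* con false :+ con false) := x :* x) refl κ x
    B-suc : ∀ x b → B x (Fin.suc b) (Fin.suc b) ≡ 0#
    B-suc x b = solve 1 (λ k →
      (con false :* con true :+ (con false :* con false :+ con false)) :* con false
      :+ ((con false :* con true :+ (con false :* k :+ con false)) :* con false :+ con false) := con false) refl κ
    kept-part : Fin (suc m) → Carrier
    kept-part a = if does (toℕ a <? suc s) then 0# else 𝟙 a a
    swapped-part : Carrier → Fin (suc m) → Carrier
    swapped-part x b = if does (toℕ b <? suc s) then (𝟙 ⊗ B x) b b else 𝟙 b b
    𝟙⊗B : ∀ x b → (𝟙 ⊗ B x) b b ≡ B x b b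
    𝟙⊗B x b = ∑-δˡ (λ j → B x j b) b
    -- Away from the first index, a swapped position meets a zero diagonal entry of `B x`, and an
    -- unswapped one contributes 1 + 1.
    rest : ∀ x b → kept-part (Fin.suc b) + swapped-part x (Fin.suc b) ≡ 0#
    rest x b with does (toℕ (Fin.suc b) <? suc s)
    ... | true  = trans (+-identityˡ _) (trans (𝟙⊗B x (Fin.suc b)) (B-suc x b))
    ... | false = x+x≡0 _
    trace≡ : ∀ x → ∑ₚ (diagonal (suc s) Y 𝟙 𝟙 (so₂ 1# 0#) (B x)) ≡ x * x
    trace≡ x = begin
      ∑ kept-part + ∑ (swapped-part x) + Tr (Y ⊗ so₂ 1# 0#)  ≡⟨ cong₂ _+_ (sym (∑-+ kept-part (swapped-part x))) TrY≡0 ⟩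
      ∑ (λ b → kept-part b + swapped-part x b) + 0#          ≡⟨ +#-identityʳ _ ⟩
      ∑ (λ b → kept-part b + swapped-part x b)               ≡⟨ cong₂ _+_ (trans (+-identityˡ _) (trans (𝟙⊗B x Fin.zero) (B-zero x)))
                                                                  (∑-zero (λ b → kept-part (Fin.suc b) + swapped-part x (Fin.suc b)) (rest x)) ⟩
      x * x + 0#                                             ≡⟨ +#-identityʳ _ ⟩
      x * x                                                  ∎

  -- Here `A` is a scalar a and nothing is swapped, so the large blocks give a + 1/a.
  traces-GL₁ : ∀ {N} {gs : Fin N → Mat (dim 1) (dim 1)} → 8 ≤ 2 ^ r →
    Enumerates (InXQσQ 1 (ρ 1) 0) gs → Separating (Attained gs)
  traces-GL₁ 8≤q enumerates = separating-⊆ {PlusInverse} (plusInverse-separating 8≤q)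
    λ { (a , a' , aa' , refl) → attained 1 (ρ 1) 0 enumerates ρ₂ (lift-ρ {1}) (λ _ _ → a) (λ _ _ → a')
          ( (λ { Fin.zero Fin.zero → trans (+#-identityʳ _) aa' })
          , (λ { Fin.zero Fin.zero → trans (+#-identityʳ _) (trans (*-comm a' a) aa') }))
          1# 0# norm-1-0 𝟘
          (trans (cong₂ _+_ (cong₂ _+_ (+#-identityʳ a) (+#-identityʳ a')) (Tr-ρ₂-so₂ 1# 0#)) (+#-identityʳ (a + a'))) }

  -- A matrix A ∈ GL₂ with trace t and determinant d has Tr A + Tr A⁻¹ = t (1 + 1/d).
  traces-GL₂ : ∀ {N} {gs : Fin N → Mat (dim 2) (dim 2)} → 4 ≤ 2 ^ r →
    Enumerates (InXQσQ 2 (ρ 2) 0) gs → Separating (Attained gs)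
  traces-GL₂ 4≤q enumerates = separating-⊆ {λ _ → ⊤} (λ b vanish → τ-nondegenerate b (λ y → vanish {y} tt))
    λ {y} _ → attained 2 (ρ 2) 0 enumerates ρ₂ (lift-ρ {2}) (A y) (A' y) (invertible y) 1# 0# norm-1-0 𝟘 (trace≡ y)
    where
    -- The determinant d must be nonzero, and different from 1 so that 1 + 1/d can be inverted.
    choice = avoid (lookup (0# ∷ 1# ∷ [])) (≤-trans (s≤s (s≤s (s≤s z≤n))) 4≤q)
    d = proj₁ choice
    d⁻¹ = inverse d (proj₂ choice Fin.zero)
    d' = proj₁ d⁻¹
    dd' : d * d' ≡ 1#
    dd' = proj₂ d⁻¹
    1+d'≢0 : 1# + d' ≢ 0#
    1+d'≢0 eq = proj₂ choice (Fin.suc Fin.zero)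
      (trans (sym (*-identityʳ d)) (trans (cong (d *_) (x+y≡0⇒x≡y eq)) dd'))
    e = proj₁ (inverse (1# + d') 1+d'≢0)
    t : Carrier → Carrier
    t y = y * e
    A A' : Carrier → Mat 2 2
    -- A companion matrix with trace t and determinant d; dividing y by 1 + 1/d to get t makes Tr A
    -- + Tr A⁻¹ equal to y.
    A y  = mat2 (t y) d 1# 0#
    A' y = mat2 0# 1# d' (t y * d')
    invertible : ∀ y → Invertible (A y) (A' y)
    invertible y = (λ where
        Fin.zero           Fin.zero           → trans (solve 3 (λ t d d' → t :* con false :+ (d :* d' :+ con false) := d :* d') refl (t y) d d') dd'
        Fin.zero           (Fin.suc Fin.zero) → trans (solve 3 (λ t d d' → t :* con true :+ (d :* (t :* d') :+ con false) := t :+ t :* (d :* d')) refl (t y) d d')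
                                                  (trans (cong (λ z → t y + t y * z) dd') (trans (cong (t y +_) (*-identityʳ _)) (x+x≡0 _)))
        (Fin.suc Fin.zero) Fin.zero           → solve 1 (λ d' → con true :* con false :+ (con false :* d' :+ con false) := con false) refl d'
        (Fin.suc Fin.zero) (Fin.suc Fin.zero) → solve 1 (λ z → con true :* con true :+ (con false :* z :+ con false) := con true) refl (t y * d'))
      , (λ where
        Fin.zero           Fin.zero           → solve 1 (λ t → con false :* t :+ (con true :* con true :+ con false) := con true) refl (t y)
        Fin.zero           (Fin.suc Fin.zero) → solve 1 (λ d → con false :* d :+ (con true :* con false :+ con false) := con false) refl d
        (Fin.suc Fin.zero) Fin.zero           → solve 2 (λ t d' → d' :* t :+ (t :* d' :* con true :+ con false) := con false) refl (t y) d'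
        (Fin.suc Fin.zero) (Fin.suc Fin.zero) → trans (solve 3 (λ t d d' → d' :* d :+ (t :* d' :* con false :+ con false) := d :* d') refl (t y) d d') dd')
    trace≡ : ∀ y → ∑ₚ (diagonal 0 ρ₂ (A y) (A' y) (so₂ 1# 0#) (ᵗ (ᵗ 𝟘 ⊗ δ ⊗ 𝟘))) ≡ y
    trace≡ y = begin
      (t y + (0# + 0#)) + (0# + (t y * d' + 0#)) + Tr (ρ₂ ⊗ so₂ 1# 0#)
        ≡⟨ cong ((t y + (0# + 0#)) + (0# + (t y * d' + 0#)) +_) (Tr-ρ₂-so₂ 1# 0#) ⟩
      (t y + (0# + 0#)) + (0# + (t y * d' + 0#)) + 0#
        ≡⟨ solve 3 (λ y e d' → (y :* e :+ (con false :+ con false)) :+ (con false :+ (y :* e :* d' :+ con false)) :+ con false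
             := y :* ((con true :+ d') :* e)) refl y e d' ⟩
      y * ((1# + d') * e)   ≡⟨ cong (y *_) (proj₂ (inverse (1# + d') 1+d'≢0)) ⟩
      y * 1#                ≡⟨ *-identityʳ y ⟩
      y                     ∎

  -- Assembling the cases by the number of swapped indices.

  module _ (irreducible : IrreducibleZ2+Z+κ) {N : ℕ} where

    -- The bound `s ≤ m` excludes m = 0 with s positive, so a positive `s` always leaves a first
    -- index to swap.
    iso-QσQ : ∀ m s → s ≤ m → (gs : Fin N → Mat (dim m) (dim m)) →
      Enumerates (InXQσQ m 𝟙 s) gs → IsLinearIsoOntoC⊥ gs
    iso-QσQ m       zero    _ gs en = code-isomorphism gs (traces-σ₀ irreducible en)
    iso-QσQ (suc m) (suc s) _ gs en = code-isomorphism gs (traces-σ₊ 𝟙 𝟙 (lift-𝟙 {suc m}) (Tr-𝟙-so₂ 1# 0#) en)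

    iso-ρQσQ : ∀ m s → (gs : Fin N → Mat (dim (suc m)) (dim (suc m))) →
      Enumerates (InXQσQ (suc m) (ρ (suc m)) (suc s)) gs → IsLinearIsoOntoC⊥ gs
    iso-ρQσQ m s gs en = code-isomorphism gs (traces-σ₊ (ρ (suc m)) ρ₂ (lift-ρ {suc m}) (Tr-ρ₂-so₂ 1# 0#) en)

    theorem : ∀ ε i m → Cases ε i (suc m) r → (gs : Fin N → Mat (dim m) (dim m)) →
      Enumerates (DC ε i m) gs → IsLinearIsoOntoC⊥ gs
    theorem plus  i1 m _ = iso-QσQ m m ≤-refl
    theorem minus i1 m _ = iso-QσQ m m ≤-refl
    theorem plus  i2 m _ = iso-QσQ m (m ∸ 1) (m∸n≤m m 1)
    theorem minus i2 m _ = iso-QσQ m (m ∸ 1) (m∸n≤m m 1)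
    theorem plus  i3 0 (inj₁ (s≤s () , _))
    theorem plus  i3 0 (inj₂ (() , _))
    theorem plus  i3 1 (inj₁ (s≤s (s≤s ()) , _))
    theorem plus  i3 1 (inj₂ (_ , 8≤q)) gs en = code-isomorphism gs (traces-GL₁ 8≤q en)
    theorem plus  i3 (suc (suc m)) _ = iso-ρQσQ (suc m) m
    theorem minus i3 0 (s≤s () , _)
    theorem minus i3 1 (s≤s (s≤s ()) , _)
    theorem minus i3 (suc (suc m)) _ = iso-ρQσQ (suc m) m
    theorem plus  i4 0 (s≤s () , _)
    theorem plus  i4 1 (s≤s (s≤s ()) , _)
    theorem plus  i4 2 (s≤s (s≤s (s≤s ())) , _)
    theorem plus  i4 (suc (suc (suc m))) _ = iso-ρQσQ (suc (suc m)) m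
    theorem minus i4 0 (inj₁ (s≤s () , _))
    theorem minus i4 0 (inj₂ (() , _))
    theorem minus i4 1 (inj₁ (s≤s (s≤s ()) , _))
    theorem minus i4 1 (inj₂ (() , _))
    theorem minus i4 2 (inj₁ (s≤s (s≤s (s≤s ())) , _))
    theorem minus i4 2 (inj₂ (_ , 4≤q)) gs en = code-isomorphism gs (traces-GL₂ 4≤q en)
    theorem minus i4 (suc (suc (suc m))) _ = iso-ρQσQ (suc (suc m)) m

theorem15 : ∀ (r : ℕ) (F : FiniteField r) (κ : FiniteField.Carrier F) →
    OverField.IrreducibleZ2+Z+κ F κ →
    ∀ (ε : Sign) (i : DCIndex) (m : ℕ) → Cases ε i (suc m) r →
    ∀ (N : ℕ) (gs : Fin N → OverField.Mat F κ (dim m) (dim m)) →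
    OverField.Enumerates F κ (OverField.DC F κ ε i m) gs →
    OverField.IsLinearIsoOntoC⊥ F κ gs
theorem15 r F κ irreducible ε i m cases N gs = OverFiniteField.theorem F κ irreducible ε i m cases gs
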